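{- For each pair of disjoint recursively enumerable sets $A,B\subseteq\mathbb{N}$ there is a $\Sigma_1$-formula $\varphi(x)$ such that for all $n\in\mathbb{N}$: if $n\in A$ then $R^\backsim\vdash_{\mathrm{QL}_0}\varphi(\overline{n})$, and if $n\in B$ then $R^\backsim\vdash_{\mathrm{QL}_0}\neg\varphi(\overline{n})$.
   Context: Propositional logic $\mathrm{L}_0$: language $\to,\wedge,\vee,\bot$; $\neg\varphi:=\varphi\to\bot$, $\varphi\leftrightarrow\psi:=(\varphi\to\psi)\wedge(\psi\to\varphi)$. Axioms: $\varphi\to\varphi$; $\varphi\wedge\psi\to\varphi$; $\varphi\wedge\psi\to\psi$; $\varphi\to\varphi\vee\psi$; $\psi\to\varphi\vee\psi$. Rules: $\varphi\rhd\psi\to\varphi$; $\varphi,\varphi\to\psi\rhd\psi$; $\varphi\rhd(\varphi\to\psi)\to\psi$; $\varphi\to\psi,\psi\to\chi\rhd\varphi\to\chi$; $\neg\varphi\vee\neg\psi\rhd\neg(\varphi\wedge\psi)$; $\chi\to\varphi,\chi\to\psi\rhd\chi\to\varphi\wedge\psi$; $\varphi\to\chi,\psi\to\chi\rhd\varphi\vee\psi\to\chi$. $\mathrm{QL}_0$: all substitution instances of these plus $(\forall x)\varphi(x)\to\varphi(t)$; $\varphi(t)\to(\exists x)\varphi(x)$; $\chi\to\psi\rhd\chi\to(\forall x)\psi$; $\psi\to\chi\rhd(\exists x)\psi\to\chi$ ($t$ substitutable for $x$, $x$ not free in $\chi$); $x=x$; $x=y\to y=x$; $x=y\to(y=z\to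 x=z)$; $x=y\to t(x)=t(y)$; $x=y\to(\varphi(x)\to\varphi(y))$. $t\neq s$ abbreviates $\neg(t=s)$. Arithmetical language: $\overline{0}$, $S$, $=$, $\leq$, ternary $A,M$; numerals $\overline{n}=S\cdots S(\overline{0})$. $(\forall x\leq y)\varphi:=(\forall x)(\neg(x\leq y)\vee\varphi)$, $(\exists x\leq y)\varphi:=(\exists x)(x\leq y\wedge\varphi)$; $\Delta_0$-formulas have only bounded quantifiers; $\Sigma_1$-formulas are $(\exists x)\psi$ with $\psi$ a $\Delta_0$-formula. $R^\backsim$: axioms $A(\overline{m},\overline{n},x)\leftrightarrow\overline{m+n}=x$; $M(\overline{m},\overline{n},x)\leftrightarrow\overline{m\cdot n}=x$; $\overline{m}\neq\overline{n}$ for $m\neq n$; $x\leq\overline{n}\leftrightarrow(x=\overline{0}\vee\dots\vee x=\overline{n})$; $x\leq\overline{n}\vee\overline{n}\leq x$; $x\leq\overline{n}\vee\neg(x\leq\overline{n})$ (for all $m,n$). -}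

module Defs where

open import Data.Nat using (ℕ; zero; suc; _+_; _*_; _<_)
open import Data.Fin using (Fin; zero; suc)
open import Data.Vec using (Vec; []; _∷_)
open import Data.Product using (Σ; _×_; ∃)
open import Data.Empty using (⊥)
open import Relation.Nullary using (¬_)
open import Function using (_∘_)
open import Relation.Binary.PropositionalEquality using (_≡_)

-- Syntax of the arithmetical language (scoped de Bruijn indices:
-- Term n / Formula n have their free variables among Fin n).
-- Symbols: 0̄, S, =, ≤, ternary A, M.

data Term (n : ℕ) : Set where
  var : Fin n → Term n
  `0  : Term n
  `S  : Term n → Term n

infixr 4 _⇒_
infixr 6 _∧'_
infixr 5 _∨'_
infix 8 _≐_ _≼_

data Formula (n : ℕ) : Set where
  _≐_  : Term n → Term n → Formula n
  _≼_  : Term n → Term n → Formula n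
  `A   : Term n → Term n → Term n → Formula n
  `M   : Term n → Term n → Term n → Formula n
  `⊥   : Formula n
  _⇒_  : Formula n → Formula n → Formula n
  _∧'_ : Formula n → Formula n → Formula n
  _∨'_ : Formula n → Formula n → Formula n
  ∀'   : Formula (suc n) → Formula n
  ∃'   : Formula (suc n) → Formula n

¬' : ∀ {n} → Formula n → Formula n
¬' φ = φ ⇒ `⊥

_⇔'_ : ∀ {n} → Formula n → Formula n → Formula n
φ ⇔' ψ = (φ ⇒ ψ) ∧' (ψ ⇒ φ)

_≠'_ : ∀ {n} → Term n → Term n → Formula n
t ≠' s = ¬' (t ≐ s)

num : ∀ {n} → ℕ → Term n
num zero    = `0
num (suc k) = `S (num k)

renT : ∀ {n m} → (Fin n → Fin m) → Term n → Term m
renT ρ (var i) = var (ρ i)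
renT ρ `0      = `0
renT ρ (`S t)  = `S (renT ρ t)

substT : ∀ {n m} → (Fin n → Term m) → Term n → Term m
substT σ (var i) = σ i
substT σ `0      = `0
substT σ (`S t)  = `S (substT σ t)

lift : ∀ {n m} → (Fin n → Term m) → Fin (suc n) → Term (suc m)
lift σ zero    = var zero
lift σ (suc i) = renT suc (σ i)

subst : ∀ {n m} → (Fin n → Term m) → Formula n → Formula m
subst σ (t ≐ s)    = substT σ t ≐ substT σ s
subst σ (t ≼ s)    = substT σ t ≼ substT σ s
subst σ (`A t s u) = `A (substT σ t) (substT σ s) (substT σ u)
subst σ (`M t s u) = `M (substT σ t) (substT σ s) (substT σ u)
subst σ `⊥         = `⊥
subst σ (φ ⇒ ψ)    = subst σ φ ⇒ subst σ ψ
subst σ (φ ∧' ψ)   = subst σ φ ∧' subst σ ψ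
subst σ (φ ∨' ψ)   = subst σ φ ∨' subst σ ψ
subst σ (∀' φ)     = ∀' (subst (lift σ) φ)
subst σ (∃' φ)     = ∃' (subst (lift σ) φ)

wk : ∀ {n} → Formula n → Formula (suc n)
wk = subst (var ∘ suc)

-- substitute t for variable 0 (the variable x of φ(x))
sub0 : ∀ {n} → Term n → Fin (suc n) → Term n
sub0 t zero    = t
sub0 t (suc i) = var i

_[_] : ∀ {n} → Formula (suc n) → Term n → Formula n
φ [ t ] = subst (sub0 t) φ

_[_]ₜ : ∀ {n} → Term (suc n) → Term n → Term n
u [ t ]ₜ = substT (sub0 t) u

∀≤ : ∀ {n} → Fin n → Formula (suc n) → Formula n
∀≤ y φ = ∀' (¬' (var zero ≼ var (suc y)) ∨' φ)

∃≤ : ∀ {n} → Fin n → Formula (suc n) → Formula n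
∃≤ y φ = ∃' ((var zero ≼ var (suc y)) ∧' φ)

data Δ₀ : ∀ {n} → Formula n → Set where
  eq  : ∀ {n} (t s : Term n) → Δ₀ (t ≐ s)
  le  : ∀ {n} (t s : Term n) → Δ₀ (t ≼ s)
  add : ∀ {n} (t s u : Term n) → Δ₀ (`A t s u)
  mul : ∀ {n} (t s u : Term n) → Δ₀ (`M t s u)
  bot : ∀ {n} → Δ₀ {n} `⊥
  imp : ∀ {n} {φ ψ : Formula n} → Δ₀ φ → Δ₀ ψ → Δ₀ (φ ⇒ ψ)
  and : ∀ {n} {φ ψ : Formula n} → Δ₀ φ → Δ₀ ψ → Δ₀ (φ ∧' ψ)
  or  : ∀ {n} {φ ψ : Formula n} → Δ₀ φ → Δ₀ ψ → Δ₀ (φ ∨' ψ)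
  all≤ : ∀ {n} (y : Fin n) {φ : Formula (suc n)} → Δ₀ φ → Δ₀ (∀≤ y φ)
  ex≤  : ∀ {n} (y : Fin n) {φ : Formula (suc n)} → Δ₀ φ → Δ₀ (∃≤ y φ)

data Σ₁ : ∀ {n} → Formula n → Set where
  sig : ∀ {n} {ψ : Formula (suc n)} → Δ₀ ψ → Σ₁ (∃' ψ)

bigDisj : ∀ {n} → Term n → ℕ → Formula n
bigDisj x zero    = x ≐ num zero
bigDisj x (suc k) = bigDisj x k ∨' (x ≐ num (suc k))

data RAx : ∀ {n} → Formula n → Set where
  ax-A   : ∀ {n} (i : Fin n) (a b : ℕ) →
           RAx (`A (num a) (num b) (var i) ⇔' (num (a + b) ≐ var i))
  ax-M   : ∀ {n} (i : Fin n) (a b : ℕ) →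
           RAx (`M (num a) (num b) (var i) ⇔' (num (a * b) ≐ var i))
  ax-neq : ∀ {n} (a b : ℕ) → ¬ (a ≡ b) → RAx {n} (num a ≠' num b)
  ax-le  : ∀ {n} (i : Fin n) (b : ℕ) →
           RAx ((var i ≼ num b) ⇔' bigDisj (var i) b)
  ax-tot : ∀ {n} (i : Fin n) (b : ℕ) →
           RAx ((var i ≼ num b) ∨' (num b ≼ var i))
  ax-dec : ∀ {n} (i : Fin n) (b : ℕ) →
           RAx ((var i ≼ num b) ∨' ¬' (var i ≼ num b))

-- All substitution instances of the QL₀ axioms/rules are included by
-- letting the schematic letters range over arbitrary formulas/terms.

infix 2 R∽⊢_

data R∽⊢_ : ∀ {n} → Formula n → Set where
  nonlog : ∀ {n} {φ : Formula n} → RAx φ → R∽⊢ φ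
  id-ax  : ∀ {n} (φ : Formula n) → R∽⊢ φ ⇒ φ
  ∧-e₁   : ∀ {n} (φ ψ : Formula n) → R∽⊢ φ ∧' ψ ⇒ φ
  ∧-e₂   : ∀ {n} (φ ψ : Formula n) → R∽⊢ φ ∧' ψ ⇒ ψ
  ∨-i₁   : ∀ {n} (φ ψ : Formula n) → R∽⊢ φ ⇒ φ ∨' ψ
  ∨-i₂   : ∀ {n} (φ ψ : Formula n) → R∽⊢ ψ ⇒ φ ∨' ψ
  weak   : ∀ {n} {φ : Formula n} (ψ : Formula n) → R∽⊢ φ → R∽⊢ ψ ⇒ φ
  mp     : ∀ {n} {φ ψ : Formula n} → R∽⊢ φ → R∽⊢ φ ⇒ ψ → R∽⊢ ψ
  app    : ∀ {n} {φ : Formula n} (ψ : Formula n) → R∽⊢ φ → R∽⊢ (φ ⇒ ψ) ⇒ ψ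
  trans  : ∀ {n} {φ ψ χ : Formula n} → R∽⊢ φ ⇒ ψ → R∽⊢ ψ ⇒ χ → R∽⊢ φ ⇒ χ
  neg∧   : ∀ {n} {φ ψ : Formula n} → R∽⊢ ¬' φ ∨' ¬' ψ → R∽⊢ ¬' (φ ∧' ψ)
  ∧-i    : ∀ {n} {φ ψ χ : Formula n} → R∽⊢ χ ⇒ φ → R∽⊢ χ ⇒ ψ → R∽⊢ χ ⇒ φ ∧' ψ
  ∨-e    : ∀ {n} {φ ψ χ : Formula n} → R∽⊢ φ ⇒ χ → R∽⊢ ψ ⇒ χ → R∽⊢ φ ∨' ψ ⇒ χ
  -- quantifier axioms and rules (x not free in χ is expressed by wk χ)
  ∀-e    : ∀ {n} (φ : Formula (suc n)) (t : Term n) → R∽⊢ ∀' φ ⇒ φ [ t ]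
  ∃-i    : ∀ {n} (φ : Formula (suc n)) (t : Term n) → R∽⊢ φ [ t ] ⇒ ∃' φ
  ∀-i    : ∀ {n} {χ : Formula n} {ψ : Formula (suc n)} →
           R∽⊢ wk χ ⇒ ψ → R∽⊢ χ ⇒ ∀' ψ
  ∃-e    : ∀ {n} {χ : Formula n} {ψ : Formula (suc n)} →
           R∽⊢ ψ ⇒ wk χ → R∽⊢ ∃' ψ ⇒ χ
  eq-refl  : ∀ {n} (t : Term n) → R∽⊢ t ≐ t
  eq-sym   : ∀ {n} (t s : Term n) → R∽⊢ t ≐ s ⇒ s ≐ t
  eq-trans : ∀ {n} (t s u : Term n) → R∽⊢ t ≐ s ⇒ (s ≐ u ⇒ t ≐ u)
  eq-fun   : ∀ {n} (t s : Term n) (u : Term (suc n)) →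
             R∽⊢ t ≐ s ⇒ u [ t ]ₜ ≐ u [ s ]ₜ
  eq-subst : ∀ {n} (t s : Term n) (φ : Formula (suc n)) →
             R∽⊢ t ≐ s ⇒ (φ [ t ] ⇒ φ [ s ])

data PRec : ℕ → Set where
  zeroF : ∀ {k} → PRec k
  succF : PRec 1
  proj  : ∀ {k} → Fin k → PRec k
  comp  : ∀ {k m} → PRec m → Vec (PRec k) m → PRec k
  prec  : ∀ {k} → PRec k → PRec (suc (suc k)) → PRec (suc k)
  mu    : ∀ {k} → PRec (suc k) → PRec k

lookupV : ∀ {A : Set} {k} → Vec A k → Fin k → A
lookupV (x ∷ xs) zero    = x
lookupV (x ∷ xs) (suc i) = lookupV xs i

mutual
  data _⟨_⟩⇓_ : ∀ {k} → PRec k → Vec ℕ k → ℕ → Set where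
    e-zero : ∀ {k} {xs : Vec ℕ k} → zeroF ⟨ xs ⟩⇓ 0
    e-succ : ∀ {x} → succF ⟨ x ∷ [] ⟩⇓ suc x
    e-proj : ∀ {k} (i : Fin k) {xs : Vec ℕ k} → proj i ⟨ xs ⟩⇓ lookupV xs i
    e-comp : ∀ {k m} {f : PRec m} {gs : Vec (PRec k) m} {xs ys y} →
             gs ⟨ xs ⟩⇓* ys → f ⟨ ys ⟩⇓ y → comp f gs ⟨ xs ⟩⇓ y
    e-prec0 : ∀ {k} {f : PRec k} {g xs y} →
              f ⟨ xs ⟩⇓ y → prec f g ⟨ 0 ∷ xs ⟩⇓ y
    e-precS : ∀ {k} {f : PRec k} {g xs x z y} →
              prec f g ⟨ x ∷ xs ⟩⇓ z → g ⟨ x ∷ z ∷ xs ⟩⇓ y →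
              prec f g ⟨ suc x ∷ xs ⟩⇓ y
    e-mu   : ∀ {k} {f : PRec (suc k)} {xs y} →
             f ⟨ y ∷ xs ⟩⇓ 0 →
             (∀ z → z < y → ∃ λ w → f ⟨ z ∷ xs ⟩⇓ suc w) →
             mu f ⟨ xs ⟩⇓ y

  data _⟨_⟩⇓*_ : ∀ {k m} → Vec (PRec k) m → Vec ℕ k → Vec ℕ m → Set where
    [] : ∀ {k} {xs : Vec ℕ k} → [] ⟨ xs ⟩⇓* []
    _∷_ : ∀ {k m} {g : PRec k} {gs : Vec (PRec k) m} {xs y ys} →
          g ⟨ xs ⟩⇓ y → gs ⟨ xs ⟩⇓* ys → (g ∷ gs) ⟨ xs ⟩⇓* (y ∷ ys)

RE : (ℕ → Set) → Set
RE A = Σ (PRec 1) λ f → ∀ n → (A n → ∃ λ y → f ⟨ n ∷ [] ⟩⇓ y)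
                            × ((∃ λ y → f ⟨ n ∷ [] ⟩⇓ y) → A n)

Disjoint : (ℕ → Set) → (ℕ → Set) → Set
Disjoint A B = ∀ n → A n → B n → ⊥

module Submission where

-- (1) Δ₀-completeness.  R∽ proves every true and refutes every false
--     numeral instance of a Δ₀-formula (Δ₀Completeness, for the Δ₀-formulas
--     in negation normal form of Bounded); the bounded quantifiers are
--     reduced to finitely many instances by the axioms for ≤.
-- (2) Δ₀ graphs.  Every partial recursive f has a Δ₀-formula G f(w, v, x⃗)
--     which holds for some bound w iff f halts on x⃗ with output v
--     (GraphFormula, GraphSoundness, GraphCompleteness); primitive recursion is
--     coded by Gödel's β-function (ChineseRemainder).  So n ∈ A iff
--     ∃c. θA(c, n) for a Δ₀-formula θA, and likewise for B (Halting).
-- (3) Rosser's trick.  ∃c. θA(c, n) ∧ ¬∃c′ ≤ c. θB(c′, n) is proved at n̄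
--     for n ∈ A and refuted for n ∈ B, by (1) and the totality of ≤ (Rosser).

open import Defs
open import Data.Nat using (ℕ)
open import Data.Product using (Σ; _×_; _,_; proj₁; proj₂)

module Substitution where

  open import Data.Nat using (zero; suc)
  open import Data.Fin using (Fin; zero; suc)
  open import Function using (_∘_)
  open import Relation.Binary.PropositionalEquality as ≡ using (_≡_; refl; cong; cong₂)

  cong₃ : ∀ {A B C D : Set} (f : A → B → C → D) {a a′ b b′ c c′} →
          a ≡ a′ → b ≡ b′ → c ≡ c′ → f a b c ≡ f a′ b′ c′
  cong₃ f refl refl refl = refl

  substT-cong : ∀ {n m} {σ τ : Fin n → Term m} → (∀ i → σ i ≡ τ i) →
                ∀ t → substT σ t ≡ substT τ t
  substT-cong e (var i) = e i
  substT-cong e `0      = refl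
  substT-cong e (`S t)  = cong `S (substT-cong e t)

  lift-cong : ∀ {n m} {σ τ : Fin n → Term m} → (∀ i → σ i ≡ τ i) →
              ∀ i → lift σ i ≡ lift τ i
  lift-cong e zero    = refl
  lift-cong e (suc i) = cong (renT suc) (e i)

  subst-cong : ∀ {n m} {σ τ : Fin n → Term m} → (∀ i → σ i ≡ τ i) →
               ∀ φ → subst σ φ ≡ subst τ φ
  subst-cong e (t ≐ s)    = cong₂ _≐_ (substT-cong e t) (substT-cong e s)
  subst-cong e (t ≼ s)    = cong₂ _≼_ (substT-cong e t) (substT-cong e s)
  subst-cong e (`A t s u) = cong₃ `A (substT-cong e t) (substT-cong e s) (substT-cong e u)
  subst-cong e (`M t s u) = cong₃ `M (substT-cong e t) (substT-cong e s) (substT-cong e u)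
  subst-cong e `⊥         = refl
  subst-cong e (φ ⇒ ψ)    = cong₂ _⇒_ (subst-cong e φ) (subst-cong e ψ)
  subst-cong e (φ ∧' ψ)   = cong₂ _∧'_ (subst-cong e φ) (subst-cong e ψ)
  subst-cong e (φ ∨' ψ)   = cong₂ _∨'_ (subst-cong e φ) (subst-cong e ψ)
  subst-cong e (∀' φ)     = cong ∀' (subst-cong (lift-cong e) φ)
  subst-cong e (∃' φ)     = cong ∃' (subst-cong (lift-cong e) φ)

  lift-renT-suc : ∀ {n m} (τ : Fin n → Term m) t →
                  substT (lift τ) (renT suc t) ≡ renT suc (substT τ t)
  lift-renT-suc τ (var i) = refl
  lift-renT-suc τ `0      = refl
  lift-renT-suc τ (`S t)  = cong `S (lift-renT-suc τ t)

  substT-fuse : ∀ {n m k} (τ : Fin m → Term k) (σ : Fin n → Term m) t →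
                substT τ (substT σ t) ≡ substT (substT τ ∘ σ) t
  substT-fuse τ σ (var i) = refl
  substT-fuse τ σ `0      = refl
  substT-fuse τ σ (`S t)  = cong `S (substT-fuse τ σ t)

  lift-fuse : ∀ {n m k} (τ : Fin m → Term k) (σ : Fin n → Term m) i →
              substT (lift τ) (lift σ i) ≡ lift (substT τ ∘ σ) i
  lift-fuse τ σ zero    = refl
  lift-fuse τ σ (suc i) = lift-renT-suc τ (σ i)

  subst-fuse : ∀ {n m k} (τ : Fin m → Term k) (σ : Fin n → Term m) φ →
               subst τ (subst σ φ) ≡ subst (substT τ ∘ σ) φ
  subst-fuse τ σ (t ≐ s)    = cong₂ _≐_ (substT-fuse τ σ t) (substT-fuse τ σ s)
  subst-fuse τ σ (t ≼ s)    = cong₂ _≼_ (substT-fuse τ σ t) (substT-fuse τ σ s)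
  subst-fuse τ σ (`A t s u) = cong₃ `A (substT-fuse τ σ t) (substT-fuse τ σ s) (substT-fuse τ σ u)
  subst-fuse τ σ (`M t s u) = cong₃ `M (substT-fuse τ σ t) (substT-fuse τ σ s) (substT-fuse τ σ u)
  subst-fuse τ σ `⊥         = refl
  subst-fuse τ σ (φ ⇒ ψ)    = cong₂ _⇒_ (subst-fuse τ σ φ) (subst-fuse τ σ ψ)
  subst-fuse τ σ (φ ∧' ψ)   = cong₂ _∧'_ (subst-fuse τ σ φ) (subst-fuse τ σ ψ)
  subst-fuse τ σ (φ ∨' ψ)   = cong₂ _∨'_ (subst-fuse τ σ φ) (subst-fuse τ σ ψ)
  subst-fuse τ σ (∀' φ)     = cong ∀' (≡.trans (subst-fuse (lift τ) (lift σ) φ) (subst-cong (lift-fuse τ σ) φ))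
  subst-fuse τ σ (∃' φ)     = cong ∃' (≡.trans (subst-fuse (lift τ) (lift σ) φ) (subst-cong (lift-fuse τ σ) φ))

  lift-var : ∀ {n} (i : Fin (suc n)) → lift (var {n}) i ≡ var i
  lift-var zero    = refl
  lift-var (suc i) = refl

  substT-id : ∀ {n} (t : Term n) → substT var t ≡ t
  substT-id (var i) = refl
  substT-id `0      = refl
  substT-id (`S t)  = cong `S (substT-id t)

  subst-id : ∀ {n} (φ : Formula n) → subst var φ ≡ φ
  subst-id (t ≐ s)    = cong₂ _≐_ (substT-id t) (substT-id s)
  subst-id (t ≼ s)    = cong₂ _≼_ (substT-id t) (substT-id s)
  subst-id (`A t s u) = cong₃ `A (substT-id t) (substT-id s) (substT-id u)
  subst-id (`M t s u) = cong₃ `M (substT-id t) (substT-id s) (substT-id u)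
  subst-id `⊥         = refl
  subst-id (φ ⇒ ψ)    = cong₂ _⇒_ (subst-id φ) (subst-id ψ)
  subst-id (φ ∧' ψ)   = cong₂ _∧'_ (subst-id φ) (subst-id ψ)
  subst-id (φ ∨' ψ)   = cong₂ _∨'_ (subst-id φ) (subst-id ψ)
  subst-id (∀' φ)     = cong ∀' (≡.trans (subst-cong lift-var φ) (subst-id φ))
  subst-id (∃' φ)     = cong ∃' (≡.trans (subst-cong lift-var φ) (subst-id φ))

  renT-as-substT : ∀ {n m} (r : Fin n → Fin m) t → renT r t ≡ substT (var ∘ r) t
  renT-as-substT r (var i) = refl
  renT-as-substT r `0      = refl
  renT-as-substT r (`S t)  = cong `S (renT-as-substT r t)

  -- Numerals are closed terms.
  substT-num : ∀ {n m} (σ : Fin n → Term m) k → substT σ (num k) ≡ num k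
  substT-num σ zero    = refl
  substT-num σ (suc k) = cong `S (substT-num σ k)

  renT-num : ∀ {n m} (ρ : Fin n → Fin m) k → renT ρ (num k) ≡ num k
  renT-num ρ zero    = refl
  renT-num ρ (suc k) = cong `S (renT-num ρ k)

  subst-bigDisj : ∀ {n m} (σ : Fin n → Term m) t b →
                  subst σ (bigDisj t b) ≡ bigDisj (substT σ t) b
  subst-bigDisj σ t zero    = cong (substT σ t ≐_) (substT-num σ zero)
  subst-bigDisj σ t (suc b) =
    cong₂ _∨'_ (subst-bigDisj σ t b) (cong (substT σ t ≐_) (substT-num σ (suc b)))

module Derivations where

  open Substitution
  open import Data.Nat using (ℕ; zero; suc; _+_; _*_; _≤_; z≤n; s≤s)
  open import Data.Nat.Properties using (m≤n⇒m<n∨m≡n; ≤-refl; ≤-trans; n≤1+n)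
  open import Data.Fin using (Fin; zero; suc)
  open import Data.Sum using (inj₁; inj₂)
  open import Relation.Nullary using (¬_)
  open import Relation.Binary.PropositionalEquality as ≡ using (_≡_; refl; cong; cong₂; sym)

  ⊢-cast : ∀ {n} {φ ψ : Formula n} → φ ≡ ψ → R∽⊢ φ → R∽⊢ ψ
  ⊢-cast refl p = p

  -- Some provable formula is needed to discharge the antecedents of rules.
  ⊢0≐0 : ∀ {n} → R∽⊢ (`0 {n} ≐ `0)
  ⊢0≐0 = eq-refl `0

  ⊢-∧ : ∀ {n} {φ ψ : Formula n} → R∽⊢ φ → R∽⊢ ψ → R∽⊢ φ ∧' ψ
  ⊢-∧ p q = mp ⊢0≐0 (∧-i (weak _ p) (weak _ q))

  ⇔-⇒ : ∀ {n} {φ ψ : Formula n} → R∽⊢ φ ⇔' ψ → R∽⊢ φ ⇒ ψ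
  ⇔-⇒ p = mp p (∧-e₁ _ _)

  ⇔-⇐ : ∀ {n} {φ ψ : Formula n} → R∽⊢ φ ⇔' ψ → R∽⊢ ψ ⇒ φ
  ⇔-⇐ p = mp p (∧-e₂ _ _)

  ⊢-gen : ∀ {n} {χ : Formula (suc n)} → R∽⊢ χ → R∽⊢ ∀' χ
  ⊢-gen p = mp ⊢0≐0 (∀-i (weak _ p))

  ⊢-inst : ∀ {n} {χ : Formula (suc n)} → R∽⊢ χ → (t : Term n) → R∽⊢ χ [ t ]
  ⊢-inst p t = mp (⊢-gen p) (∀-e _ t)

  ≼-axiom : ∀ {m} a b → R∽⊢ (num {m} a ≼ num b) ⇔' bigDisj (num a) b
  ≼-axiom {m} a b =
    ⊢-cast (cong₂ (λ X Y → (num a ≼ X) ⇔' Y) (substT-num _ b) (subst-bigDisj _ (var zero) b))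
           (⊢-inst (nonlog (ax-le {suc m} zero b)) (num a))

  A-axiom : ∀ {m} a b c → R∽⊢ `A (num {m} a) (num b) (num c) ⇔' (num (a + b) ≐ num c)
  A-axiom {m} a b c =
    ⊢-cast (cong₃ (λ X Y Z → `A X Y (num c) ⇔' (Z ≐ num c))
                  (substT-num _ a) (substT-num _ b) (substT-num _ (a + b)))
           (⊢-inst (nonlog (ax-A {suc m} zero a b)) (num c))

  M-axiom : ∀ {m} a b c → R∽⊢ `M (num {m} a) (num b) (num c) ⇔' (num (a * b) ≐ num c)
  M-axiom {m} a b c =
    ⊢-cast (cong₃ (λ X Y Z → `M X Y (num c) ⇔' (Z ≐ num c))
                  (substT-num _ a) (substT-num _ b) (substT-num _ (a * b)))
           (⊢-inst (nonlog (ax-M {suc m} zero a b)) (num c))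

  num-≐ : ∀ {m} {a b} → a ≡ b → R∽⊢ num {m} a ≐ num b
  num-≐ {b = b} refl = eq-refl (num b)

  num-≠ : ∀ {m} {a b} → ¬ (a ≡ b) → R∽⊢ ¬' (num {m} a ≐ num b)
  num-≠ a≢b = nonlog (ax-neq _ _ a≢b)

  bigDisj-elim : ∀ {m} (t : Term m) {χ : Formula m} b →
                 (∀ j → j ≤ b → R∽⊢ (t ≐ num j) ⇒ χ) → R∽⊢ bigDisj t b ⇒ χ
  bigDisj-elim t zero    h = h zero z≤n
  bigDisj-elim t (suc b) h =
    ∨-e (bigDisj-elim t b (λ j j≤b → h j (≤-trans j≤b (n≤1+n b)))) (h (suc b) ≤-refl)

  bigDisj-intro : ∀ {m} a b → a ≤ b → R∽⊢ bigDisj (num {m} a) b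
  bigDisj-intro zero zero z≤n = eq-refl `0
  bigDisj-intro a (suc b) a≤1+b with m≤n⇒m<n∨m≡n a≤1+b
  ... | inj₁ (s≤s a≤b) = mp (bigDisj-intro a b a≤b) (∨-i₁ _ _)
  ... | inj₂ refl      = mp (eq-refl _) (∨-i₂ _ _)

  num-≼ : ∀ {m} {a b} → a ≤ b → R∽⊢ num {m} a ≼ num b
  num-≼ {a = a} {b} a≤b = mp (bigDisj-intro a b a≤b) (⇔-⇐ (≼-axiom a b))

  num-⋠ : ∀ {m} {a b} → ¬ (a ≤ b) → R∽⊢ ¬' (num {m} a ≼ num b)
  num-⋠ {a = a} {b} a≰b =
    trans (⇔-⇒ (≼-axiom a b)) (bigDisj-elim _ b (λ j j≤b → num-≠ (λ { refl → a≰b j≤b })))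

  fix₀ : ∀ {m} → ℕ → Fin (suc m) → Term (suc m)
  fix₀ j zero    = num j
  fix₀ j (suc i) = var (suc i)

  ≐-transport : ∀ {m} j (χ : Formula (suc m)) → R∽⊢ subst (fix₀ j) χ → R∽⊢ (var zero ≐ num j) ⇒ χ
  ≐-transport j χ p =
    ⊢-cast (cong ((var zero ≐ num j) ⇒_) Φ[x₀]≡χ)
           (trans (trans (eq-sym (var zero) (num j)) (eq-subst (num j) (var zero) Φ))
                  (app _ (⊢-cast (sym Φ[j]≡χj) p)))
    where
    -- Φ lives one context up, so that Φ [ t ] is χ with x₀ := t.
    shift : ∀ {m} → Fin (suc m) → Term (suc (suc m))
    shift zero    = var zero
    shift (suc i) = var (suc (suc i))
    Φ = subst shift χ
    Φ[j]≡χj : Φ [ num j ] ≡ subst (fix₀ j) χ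
    Φ[j]≡χj = ≡.trans (subst-fuse _ shift χ) (subst-cong (λ { zero → refl ; (suc i) → refl }) χ)
    Φ[x₀]≡χ : Φ [ var zero ] ≡ χ
    Φ[x₀]≡χ = ≡.trans (subst-fuse _ shift χ)
                      (≡.trans (subst-cong (λ { zero → refl ; (suc i) → refl }) χ) (subst-id χ))

  ≼-bounded : ∀ {m} b (χ : Formula (suc m)) → (∀ j → j ≤ b → R∽⊢ subst (fix₀ j) χ) →
              R∽⊢ (var zero ≼ num b) ⇒ χ
  ≼-bounded b χ h =
    trans (⇔-⇒ (nonlog (ax-le zero b))) (bigDisj-elim (var zero) b (λ j j≤b → ≐-transport j χ (h j j≤b)))

  ≼-bounded-∨ : ∀ {m} b (χ : Formula (suc m)) → (∀ j → j ≤ b → R∽⊢ subst (fix₀ j) χ) →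
                R∽⊢ ¬' (var zero ≼ num b) ∨' χ
  ≼-bounded-∨ b χ h = mp (nonlog (ax-dec zero b)) (∨-e (trans (≼-bounded b χ h) (∨-i₂ _ _)) (∨-i₁ _ _))

module Bounded where

  -- Δ₀-formulas in negation normal form, with their standard semantics in ℕ.

  open Substitution
  open import Data.Nat using (ℕ; zero; suc; _+_; _*_; _≤_; s≤s; _≤?_; _≟_; allUpTo?; anyUpTo?)
  open import Data.Nat.Properties using (≤-pred)
  open import Data.Fin using (Fin; zero; suc)
  open import Data.Empty using (⊥-elim)
  open import Data.Product using (Σ; _×_; _,_)
  open import Data.Product.Function.NonDependent.Propositional using (_×-⇔_)
  open import Data.Sum using (_⊎_)
  open import Data.Sum.Function.Propositional using (_⊎-⇔_)
  open import Function using (_∘_; _⇔_; mk⇔; Equivalence)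
  open Equivalence using (to; from)
  open import Function.Related.TypeIsomorphisms using (¬-cong-⇔)
  open import Relation.Nullary using (¬_; Dec; yes; no; ¬?; _×-dec_; _⊎-dec_)
  open import Relation.Nullary.Decidable using (map′; decidable-stable)
  open import Relation.Binary.PropositionalEquality as ≡ using (_≡_; refl; cong; cong₂; sym)

  data Atom (n : ℕ) : Set where
    eqA leA   : Term n → Term n → Atom n
    addA mulA : Term n → Term n → Term n → Atom n

  infixr 6 _∧D_
  infixr 5 _∨D_

  data D (n : ℕ) : Set where
    pos neg   : Atom n → D n
    _∧D_ _∨D_ : D n → D n → D n
    allD exD  : Fin n → D (suc n) → D n

  ⌜_⌝A : ∀ {n} → Atom n → Formula n
  ⌜ eqA t s ⌝A    = t ≐ s
  ⌜ leA t s ⌝A    = t ≼ s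
  ⌜ addA t s u ⌝A = `A t s u
  ⌜ mulA t s u ⌝A = `M t s u

  ⌜_⌝ : ∀ {n} → D n → Formula n
  ⌜ pos a ⌝      = ⌜ a ⌝A
  ⌜ neg a ⌝      = ¬' ⌜ a ⌝A
  ⌜ d ∧D e ⌝     = ⌜ d ⌝ ∧' ⌜ e ⌝
  ⌜ d ∨D e ⌝     = ⌜ d ⌝ ∨' ⌜ e ⌝
  ⌜ allD y d ⌝   = ∀≤ y ⌜ d ⌝
  ⌜ exD y d ⌝    = ∃≤ y ⌜ d ⌝

  ⌜⌝A-Δ₀ : ∀ {n} (a : Atom n) → Δ₀ ⌜ a ⌝A
  ⌜⌝A-Δ₀ (eqA t s)    = eq t s
  ⌜⌝A-Δ₀ (leA t s)    = le t s
  ⌜⌝A-Δ₀ (addA t s u) = add t s u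
  ⌜⌝A-Δ₀ (mulA t s u) = mul t s u

  ⌜⌝-Δ₀ : ∀ {n} (d : D n) → Δ₀ ⌜ d ⌝
  ⌜⌝-Δ₀ (pos a)    = ⌜⌝A-Δ₀ a
  ⌜⌝-Δ₀ (neg a)    = imp (⌜⌝A-Δ₀ a) bot
  ⌜⌝-Δ₀ (d ∧D e)   = and (⌜⌝-Δ₀ d) (⌜⌝-Δ₀ e)
  ⌜⌝-Δ₀ (d ∨D e)   = or (⌜⌝-Δ₀ d) (⌜⌝-Δ₀ e)
  ⌜⌝-Δ₀ (allD y d) = all≤ y (⌜⌝-Δ₀ d)
  ⌜⌝-Δ₀ (exD y d)  = ex≤ y (⌜⌝-Δ₀ d)

  Env : ℕ → Set
  Env n = Fin n → ℕ

  infixr 5 _∷ₑ_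
  _∷ₑ_ : ∀ {n} → ℕ → Env n → Env (suc n)
  (j ∷ₑ ρ) zero    = j
  (j ∷ₑ ρ) (suc i) = ρ i

  ⟨_⟩ : ℕ → Env 1
  ⟨ n ⟩ zero = n

  _،_ : ℕ → ℕ → Env 2
  c ، n = c ∷ₑ ⟨ n ⟩

  evT : ∀ {n} → Env n → Term n → ℕ
  evT ρ (var i) = ρ i
  evT ρ `0      = 0
  evT ρ (`S t)  = suc (evT ρ t)

  ⟦_⟧A : ∀ {n} → Atom n → Env n → Set
  ⟦ eqA t s ⟧A ρ    = evT ρ t ≡ evT ρ s
  ⟦ leA t s ⟧A ρ    = evT ρ t ≤ evT ρ s
  ⟦ addA t s u ⟧A ρ = evT ρ t + evT ρ s ≡ evT ρ u
  ⟦ mulA t s u ⟧A ρ = evT ρ t * evT ρ s ≡ evT ρ u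

  ⟦_⟧ : ∀ {n} → D n → Env n → Set
  ⟦ pos a ⟧ ρ    = ⟦ a ⟧A ρ
  ⟦ neg a ⟧ ρ    = ¬ ⟦ a ⟧A ρ
  ⟦ d ∧D e ⟧ ρ   = ⟦ d ⟧ ρ × ⟦ e ⟧ ρ
  ⟦ d ∨D e ⟧ ρ   = ⟦ d ⟧ ρ ⊎ ⟦ e ⟧ ρ
  ⟦ allD y d ⟧ ρ = ∀ j → j ≤ ρ y → ⟦ d ⟧ (j ∷ₑ ρ)
  ⟦ exD y d ⟧ ρ  = Σ ℕ λ j → j ≤ ρ y × ⟦ d ⟧ (j ∷ₑ ρ)

  all≤? : ∀ {P : ℕ → Set} → (∀ j → Dec (P j)) → ∀ b → Dec (∀ j → j ≤ b → P j)
  all≤? P? b = map′ (λ h j j≤b → h (s≤s j≤b)) (λ h {j} j<1+b → h j (≤-pred j<1+b)) (allUpTo? P? (suc b))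

  any≤? : ∀ {P : ℕ → Set} → (∀ j → Dec (P j)) → ∀ b → Dec (Σ ℕ λ j → j ≤ b × P j)
  any≤? P? b = map′ (λ { (j , s≤s j≤b , p) → j , j≤b , p }) (λ { (j , j≤b , p) → j , s≤s j≤b , p })
                    (anyUpTo? P? (suc b))

  ¬all≤⇒any≤¬ : ∀ {P : ℕ → Set} → (∀ j → Dec (P j)) → ∀ b →
                ¬ (∀ j → j ≤ b → P j) → Σ ℕ λ j → j ≤ b × ¬ P j
  ¬all≤⇒any≤¬ P? b ¬all with any≤? (λ j → ¬? (P? j)) b
  ... | yes counterexample = counterexample
  ... | no  none           = ⊥-elim (¬all λ j j≤b → decidable-stable (P? j) (λ ¬p → none (j , j≤b , ¬p)))

  ⟦⟧A? : ∀ {n} (a : Atom n) ρ → Dec (⟦ a ⟧A ρ)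
  ⟦⟧A? (eqA t s) ρ    = evT ρ t ≟ evT ρ s
  ⟦⟧A? (leA t s) ρ    = evT ρ t ≤? evT ρ s
  ⟦⟧A? (addA t s u) ρ = evT ρ t + evT ρ s ≟ evT ρ u
  ⟦⟧A? (mulA t s u) ρ = evT ρ t * evT ρ s ≟ evT ρ u

  ⟦⟧? : ∀ {n} (d : D n) ρ → Dec (⟦ d ⟧ ρ)
  ⟦⟧? (pos a) ρ    = ⟦⟧A? a ρ
  ⟦⟧? (neg a) ρ    = ¬? (⟦⟧A? a ρ)
  ⟦⟧? (d ∧D e) ρ   = ⟦⟧? d ρ ×-dec ⟦⟧? e ρ
  ⟦⟧? (d ∨D e) ρ   = ⟦⟧? d ρ ⊎-dec ⟦⟧? e ρ
  ⟦⟧? (allD y d) ρ = all≤? (λ j → ⟦⟧? d (j ∷ₑ ρ)) (ρ y)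
  ⟦⟧? (exD y d) ρ  = any≤? (λ j → ⟦⟧? d (j ∷ₑ ρ)) (ρ y)

  liftR : ∀ {n m} → (Fin n → Fin m) → Fin (suc n) → Fin (suc m)
  liftR r zero    = zero
  liftR r (suc i) = suc (r i)

  renA : ∀ {n m} → (Fin n → Fin m) → Atom n → Atom m
  renA r (eqA t s)    = eqA (renT r t) (renT r s)
  renA r (leA t s)    = leA (renT r t) (renT r s)
  renA r (addA t s u) = addA (renT r t) (renT r s) (renT r u)
  renA r (mulA t s u) = mulA (renT r t) (renT r s) (renT r u)

  renD : ∀ {n m} → (Fin n → Fin m) → D n → D m
  renD r (pos a)    = pos (renA r a)
  renD r (neg a)    = neg (renA r a)
  renD r (d ∧D e)   = renD r d ∧D renD r e
  renD r (d ∨D e)   = renD r d ∨D renD r e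
  renD r (allD y d) = allD (r y) (renD (liftR r) d)
  renD r (exD y d)  = exD (r y) (renD (liftR r) d)

  ⌜renA⌝ : ∀ {n m} (r : Fin n → Fin m) a → ⌜ renA r a ⌝A ≡ subst (var ∘ r) ⌜ a ⌝A
  ⌜renA⌝ r (eqA t s)    = cong₂ _≐_ (renT-as-substT r t) (renT-as-substT r s)
  ⌜renA⌝ r (leA t s)    = cong₂ _≼_ (renT-as-substT r t) (renT-as-substT r s)
  ⌜renA⌝ r (addA t s u) = cong₃ `A (renT-as-substT r t) (renT-as-substT r s) (renT-as-substT r u)
  ⌜renA⌝ r (mulA t s u) = cong₃ `M (renT-as-substT r t) (renT-as-substT r s) (renT-as-substT r u)

  ⌜renD⌝ : ∀ {n m} (r : Fin n → Fin m) d → ⌜ renD r d ⌝ ≡ subst (var ∘ r) ⌜ d ⌝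
  ⌜renD⌝ r (pos a)    = ⌜renA⌝ r a
  ⌜renD⌝ r (neg a)    = cong ¬' (⌜renA⌝ r a)
  ⌜renD⌝ r (d ∧D e)   = cong₂ _∧'_ (⌜renD⌝ r d) (⌜renD⌝ r e)
  ⌜renD⌝ r (d ∨D e)   = cong₂ _∨'_ (⌜renD⌝ r d) (⌜renD⌝ r e)
  ⌜renD⌝ r (allD y d) = cong (λ X → ∀' (¬' (var zero ≼ var (suc (r y))) ∨' X))
                             (≡.trans (⌜renD⌝ (liftR r) d) (subst-cong (λ { zero → refl ; (suc i) → refl }) ⌜ d ⌝))
  ⌜renD⌝ r (exD y d)  = cong (λ X → ∃' ((var zero ≼ var (suc (r y))) ∧' X))
                             (≡.trans (⌜renD⌝ (liftR r) d) (subst-cong (λ { zero → refl ; (suc i) → refl }) ⌜ d ⌝))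

  -- Pointwise equality of environments; '(ρ ∘ r) ≗ ρ′' says that the
  -- renaming r maps the variables of ρ′ to variables of ρ with the same values.
  _≗_ : ∀ {n} → Env n → Env n → Set
  ρ ≗ ρ′ = ∀ i → ρ i ≡ ρ′ i

  evT-ren : ∀ {n m} {r : Fin n → Fin m} {ρ ρ′} → (ρ ∘ r) ≗ ρ′ → ∀ t → evT ρ (renT r t) ≡ evT ρ′ t
  evT-ren e (var i) = e i
  evT-ren e `0      = refl
  evT-ren e (`S t)  = cong suc (evT-ren e t)

  ≡-⇔ : ∀ (R : ℕ → ℕ → Set) {a a′ b b′} → a ≡ a′ → b ≡ b′ → R a b ⇔ R a′ b′
  ≡-⇔ R refl refl = mk⇔ (λ x → x) (λ x → x)

  ⟦renA⟧ : ∀ {n m} {r : Fin n → Fin m} {ρ ρ′} → (ρ ∘ r) ≗ ρ′ → ∀ a → ⟦ renA r a ⟧A ρ ⇔ ⟦ a ⟧A ρ′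
  ⟦renA⟧ e (eqA t s)    = ≡-⇔ _≡_ (evT-ren e t) (evT-ren e s)
  ⟦renA⟧ e (leA t s)    = ≡-⇔ _≤_ (evT-ren e t) (evT-ren e s)
  ⟦renA⟧ e (addA t s u) = ≡-⇔ _≡_ (cong₂ _+_ (evT-ren e t) (evT-ren e s)) (evT-ren e u)
  ⟦renA⟧ e (mulA t s u) = ≡-⇔ _≡_ (cong₂ _*_ (evT-ren e t) (evT-ren e s)) (evT-ren e u)

  liftR-≗ : ∀ {n m} {r : Fin n → Fin m} {ρ ρ′} → (ρ ∘ r) ≗ ρ′ → ∀ j → ((j ∷ₑ ρ) ∘ liftR r) ≗ (j ∷ₑ ρ′)
  liftR-≗ e j zero    = refl
  liftR-≗ e j (suc i) = e i

  ⟦renD⟧ : ∀ {n m} {r : Fin n → Fin m} {ρ ρ′} → (ρ ∘ r) ≗ ρ′ → ∀ d → ⟦ renD r d ⟧ ρ ⇔ ⟦ d ⟧ ρ′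
  ⟦renD⟧ e (pos a)    = ⟦renA⟧ e a
  ⟦renD⟧ e (neg a)    = ¬-cong-⇔ (⟦renA⟧ e a)
  ⟦renD⟧ e (d ∧D d′)  = ⟦renD⟧ e d ×-⇔ ⟦renD⟧ e d′
  ⟦renD⟧ e (d ∨D d′)  = ⟦renD⟧ e d ⊎-⇔ ⟦renD⟧ e d′
  ⟦renD⟧ e (allD y d) =
    mk⇔ (λ h j j≤ → to   (⟦renD⟧ (liftR-≗ e j) d) (h j (≡.subst (j ≤_) (sym (e y)) j≤)))
        (λ h j j≤ → from (⟦renD⟧ (liftR-≗ e j) d) (h j (≡.subst (j ≤_) (e y) j≤)))
  ⟦renD⟧ e (exD y d)  =
    mk⇔ (λ { (j , j≤ , p) → j , ≡.subst (j ≤_) (e y) j≤ , to (⟦renD⟧ (liftR-≗ e j) d) p })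
        (λ { (j , j≤ , p) → j , ≡.subst (j ≤_) (sym (e y)) j≤ , from (⟦renD⟧ (liftR-≗ e j) d) p })

module Δ₀Completeness where

  -- The bounded
  -- quantifiers are handled by the axioms for ≤, which reduce them to
  -- finitely many numeral instances.

  open Substitution
  open Derivations
  open Bounded
  open import Data.Nat using (ℕ; zero; suc; _≤_)
  open import Data.Fin using (Fin; zero; suc)
  open import Data.Product using (Σ; _×_; _,_; proj₁; proj₂)
  open import Data.Sum using (_⊎_; inj₁; inj₂)
  open import Function using (_∘_; case_of_)
  open import Relation.Nullary using (¬_; Dec; yes; no)
  open import Relation.Nullary.Decidable using (decidable-stable)
  open import Relation.Binary.PropositionalEquality as ≡ using (_≡_; refl; cong; sym)

  Decides : ∀ {n} → Set → Formula n → Set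
  Decides P φ = (P → R∽⊢ φ) × (¬ P → R∽⊢ ¬' φ)

  Represents : ∀ {n m} → Env n → (Fin n → Term m) → Set
  Represents ρ σ = ∀ i → σ i ≡ num (ρ i)

  substT-represents : ∀ {n m} {ρ : Env n} {σ : Fin n → Term m} → Represents ρ σ →
                      ∀ t → substT σ t ≡ num (evT ρ t)
  substT-represents g (var i) = g i
  substT-represents g `0      = refl
  substT-represents g (`S t)  = cong `S (substT-represents g t)

  represents-under : ∀ {n m k} {ρ : Env n} {σ : Fin n → Term m} → Represents ρ σ →
                     (τ : Fin (suc m) → Term k) → ∀ {j} → τ zero ≡ num j →
                     Represents (j ∷ₑ ρ) (substT τ ∘ lift σ)
  represents-under g τ e zero    = e
  represents-under {ρ = ρ} g τ e (suc i) rewrite g i =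
    ≡.trans (cong (substT τ) (renT-num suc (ρ i))) (substT-num τ (ρ i))

  represents-shift : ∀ {n m} {ρ : Env n} {σ : Fin n → Term m} → Represents ρ σ →
                     ∀ i → renT suc (σ i) ≡ num (ρ i)
  represents-shift g i rewrite g i = renT-num suc _

  atom-decided : ∀ {n m} {ρ : Env n} {σ : Fin n → Term m} → Represents ρ σ →
                 ∀ a → Decides (⟦ a ⟧A ρ) (subst σ ⌜ a ⌝A)
  atom-decided g (eqA t s) rewrite substT-represents g t | substT-represents g s = num-≐ , num-≠
  atom-decided g (leA t s) rewrite substT-represents g t | substT-represents g s = num-≼ , num-⋠
  atom-decided g (addA t s u)
    rewrite substT-represents g t | substT-represents g s | substT-represents g u =
    (λ h → mp (num-≐ h) (⇔-⇐ (A-axiom _ _ _))) , (λ h → trans (⇔-⇒ (A-axiom _ _ _)) (num-≠ h))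
  atom-decided g (mulA t s u)
    rewrite substT-represents g t | substT-represents g s | substT-represents g u =
    (λ h → mp (num-≐ h) (⇔-⇐ (M-axiom _ _ _))) , (λ h → trans (⇔-⇒ (M-axiom _ _ _)) (num-≠ h))

  ¬-decided : ∀ {n P} {φ : Formula n} → Dec P → Decides P φ → Decides (¬ P) (¬' φ)
  ¬-decided P? (prove , refute) = refute , λ ¬¬p → app `⊥ (prove (decidable-stable P? ¬¬p))

  ∧-decided : ∀ {n P Q} {φ ψ : Formula n} → Dec P → Decides P φ → Decides Q ψ → Decides (P × Q) (φ ∧' ψ)
  ∧-decided P? (proveφ , refuteφ) (proveψ , refuteψ) = (λ { (p , q) → ⊢-∧ (proveφ p) (proveψ q) }) , refute
    where
    refute : ¬ (_ × _) → R∽⊢ ¬' (_ ∧' _)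
    refute ¬pq = neg∧ (case P? of λ
      { (no ¬p) → mp (refuteφ ¬p) (∨-i₁ _ _)
      ; (yes p) → mp (refuteψ (λ q → ¬pq (p , q))) (∨-i₂ _ _) })

  ∨-decided : ∀ {n P Q} {φ ψ : Formula n} → Decides P φ → Decides Q ψ → Decides (P ⊎ Q) (φ ∨' ψ)
  ∨-decided (proveφ , refuteφ) (proveψ , refuteψ) =
    (λ { (inj₁ p) → mp (proveφ p) (∨-i₁ _ _) ; (inj₂ q) → mp (proveψ q) (∨-i₂ _ _) }) ,
    (λ ¬p∨q → ∨-e (refuteφ (¬p∨q ∘ inj₁)) (refuteψ (¬p∨q ∘ inj₂)))

  ∀≤-decided : ∀ {m} b (χ : Formula (suc m)) {P : ℕ → Set} → (∀ j → Dec (P j)) →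
               (∀ j → Decides (P j) (subst (fix₀ j) χ)) → (∀ j → Decides (P j) (χ [ num j ])) →
               Decides (∀ j → j ≤ b → P j) (∀' (¬' (var zero ≼ num b) ∨' χ))
  ∀≤-decided b χ P? fixed closed =
    (λ all → ⊢-gen (≼-bounded-∨ b χ λ j j≤b → proj₁ (fixed j) (all j j≤b))) ,
    λ ¬all → refute (¬all≤⇒any≤¬ P? b ¬all)
    where
    refute : (Σ ℕ λ j → j ≤ b × ¬ _) → R∽⊢ ¬' (∀' (¬' (var zero ≼ num b) ∨' χ))
    refute (j , j≤b , ¬p) =
      trans (∀-e _ (num j))
            (⊢-cast (cong (λ t → ¬' (¬' (num j ≼ t) ∨' χ [ num j ])) (sym (substT-num _ b)))
                    (∨-e (app `⊥ (num-≼ j≤b)) (proj₂ (closed j) ¬p)))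

  ∃≤-decided : ∀ {m} b (χ : Formula (suc m)) {P : ℕ → Set} →
               (∀ j → Decides (P j) (subst (fix₀ j) χ)) → (∀ j → Decides (P j) (χ [ num j ])) →
               Decides (Σ ℕ λ j → j ≤ b × P j) (∃' ((var zero ≼ num b) ∧' χ))
  ∃≤-decided b χ fixed closed =
    (λ { (j , j≤b , p) →
         mp (⊢-cast (cong (λ t → (num j ≼ t) ∧' χ [ num j ]) (sym (substT-num _ b)))
                    (⊢-∧ (num-≼ j≤b) (proj₁ (closed j) p)))
            (∃-i _ (num j)) }) ,
    λ none → ∃-e (neg∧ (≼-bounded-∨ b (¬' χ) λ j j≤b → proj₂ (fixed j) λ p → none (j , j≤b , p)))

  mutual
    Δ₀-complete : ∀ {n m} (d : D n) (ρ : Env n) (σ : Fin n → Term m) → Represents ρ σ →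
                  Decides (⟦ d ⟧ ρ) (subst σ ⌜ d ⌝)
    Δ₀-complete (pos a) ρ σ g    = atom-decided g a
    Δ₀-complete (neg a) ρ σ g    = ¬-decided (⟦⟧A? a ρ) (atom-decided g a)
    Δ₀-complete (d ∧D e) ρ σ g   = ∧-decided (⟦⟧? d ρ) (Δ₀-complete d ρ σ g) (Δ₀-complete e ρ σ g)
    Δ₀-complete (d ∨D e) ρ σ g   = ∨-decided (Δ₀-complete d ρ σ g) (Δ₀-complete e ρ σ g)
    Δ₀-complete (allD y d) ρ σ g =
      ≡.subst (λ t → Decides _ (∀' (¬' (var zero ≼ t) ∨' subst (lift σ) ⌜ d ⌝))) (sym (represents-shift g y))
              (∀≤-decided (ρ y) _ (λ j → ⟦⟧? d (j ∷ₑ ρ))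
                          (λ j → Δ₀-complete-under d ρ σ g (fix₀ j) refl)
                          (λ j → Δ₀-complete-under d ρ σ g (sub0 (num j)) refl))
    Δ₀-complete (exD y d) ρ σ g  =
      ≡.subst (λ t → Decides _ (∃' ((var zero ≼ t) ∧' subst (lift σ) ⌜ d ⌝))) (sym (represents-shift g y))
              (∃≤-decided (ρ y) _ (λ j → Δ₀-complete-under d ρ σ g (fix₀ j) refl)
                                  (λ j → Δ₀-complete-under d ρ σ g (sub0 (num j)) refl))

    Δ₀-complete-under : ∀ {n m k} (d : D (suc n)) (ρ : Env n) (σ : Fin n → Term m) → Represents ρ σ →
                        (τ : Fin (suc m) → Term k) → ∀ {j} → τ zero ≡ num j →
                        Decides (⟦ d ⟧ (j ∷ₑ ρ)) (subst τ (subst (lift σ) ⌜ d ⌝))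
    Δ₀-complete-under d ρ σ g τ {j} e =
      ≡.subst (Decides _) (sym (subst-fuse τ (lift σ) ⌜ d ⌝))
              (Δ₀-complete d (j ∷ₑ ρ) (substT τ ∘ lift σ) (represents-under g τ e))

module ChineseRemainder where

  -- For D a multiple of x! the moduli 1 + (1+i)·D are pairwise coprime, and
  -- c is given by the Chinese remainder theorem, proved by induction on x
  -- with Bézout inverses.

  open import Data.Nat using (ℕ; zero; suc; _+_; _*_; _≤_; _∸_; s≤s; _!)
  open import Data.Nat.Properties
  open import Data.Nat.DivMod
  open import Data.Nat.Divisibility
  open import Data.Nat.Coprimality as Coprime using (Coprime; coprime-Bézout; coprime-divisor)
  open import Data.Nat.GCD using (module Bézout)
  open import Data.Nat.Combinatorics using (k![n∸k]!∣n!)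
  open import Data.Nat.Solver using (module +-*-Solver)
  open import Data.Product using (Σ; _×_; _,_; proj₁; proj₂)
  open import Data.Sum using (inj₁; inj₂)
  open import Relation.Binary.PropositionalEquality as ≡ using (_≡_; refl; cong; cong₂; sym)
  open +-*-Solver

  -- Congruence modulo 1+m (the successor avoids a non-zero side condition).
  record _≡[_]_ (a m b : ℕ) : Set where
    constructor mod-eq
    field mod-eq⁻¹ : a % suc m ≡ b % suc m
  open _≡[_]_

  ≡[]-refl : ∀ {m} a → a ≡[ m ] a
  ≡[]-refl a = mod-eq refl

  ≡[]-sym : ∀ {m a b} → a ≡[ m ] b → b ≡[ m ] a
  ≡[]-sym (mod-eq p) = mod-eq (sym p)

  ≡[]-trans : ∀ {m a b c} → a ≡[ m ] b → b ≡[ m ] c → a ≡[ m ] c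
  ≡[]-trans (mod-eq p) (mod-eq q) = mod-eq (≡.trans p q)

  ≡⇒≡[] : ∀ {m a b} → a ≡ b → a ≡[ m ] b
  ≡⇒≡[] refl = mod-eq refl

  +-≡[] : ∀ {m a b c d} → a ≡[ m ] b → c ≡[ m ] d → (a + c) ≡[ m ] (b + d)
  +-≡[] {m} {a} {b} {c} {d} (mod-eq p) (mod-eq q) = mod-eq (≡.trans (%-distribˡ-+ a c (suc m))
    (≡.trans (cong₂ (λ x y → (x + y) % suc m) p q) (sym (%-distribˡ-+ b d (suc m)))))

  *-≡[] : ∀ {m a b c d} → a ≡[ m ] b → c ≡[ m ] d → (a * c) ≡[ m ] (b * d)
  *-≡[] {m} {a} {b} {c} {d} (mod-eq p) (mod-eq q) = mod-eq (≡.trans (%-distribˡ-* a c (suc m))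
    (≡.trans (cong₂ (λ x y → (x * y) % suc m) p q) (sym (%-distribˡ-* b d (suc m)))))

  +multiple-≡[] : ∀ {m} a k → (a + k * suc m) ≡[ m ] a
  +multiple-≡[] {m} a k = mod-eq ([m+kn]%n≡m%n a k (suc m))

  inverse : ∀ P m → Coprime P (suc m) → Σ ℕ λ e → (P * e) ≡[ m ] 1
  inverse P m c with coprime-Bézout c
  ... | Bézout.+- x y 1+y[1+m]≡xP =
    x , ≡[]-trans (≡⇒≡[] (≡.trans (*-comm P x) (sym 1+y[1+m]≡xP))) (+multiple-≡[] 1 y)
  ... | Bézout.-+ x y 1+xP≡y[1+m] =
    x * m , ≡[]-trans (≡[]-sym (+multiple-≡[] (P * (x * m)) 1))
                      (≡[]-trans (≡⇒≡[] identity) (+multiple-≡[] 1 (y * m)))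
    where
    open ≡.≡-Reasoning
    identity : P * (x * m) + 1 * suc m ≡ 1 + (y * m) * suc m
    identity = begin
      P * (x * m) + 1 * suc m ≡⟨ solve 3 (λ P x m → P :* (x :* m) :+ con 1 :* (con 1 :+ m)
                                                   := (con 1 :+ x :* P) :* m :+ con 1) refl P x m ⟩
      (1 + x * P) * m + 1     ≡⟨ cong (λ z → z * m + 1) 1+xP≡y[1+m] ⟩
      y * suc m * m + 1       ≡⟨ solve 3 (λ y m M → y :* M :* m :+ con 1 := con 1 :+ (y :* m) :* M) refl y m (suc m) ⟩
      1 + (y * m) * suc m     ∎

  coprime-* : ∀ {a b c} → Coprime a b → Coprime a c → Coprime a (b * c)
  coprime-* {a} {b} {c} a⊥b a⊥c {g} (g∣a , g∣bc) = a⊥c (g∣a , coprime-divisor g⊥b g∣bc)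
    where
    g⊥b : Coprime g b
    g⊥b (h∣g , h∣b) = a⊥b (∣-trans h∣g g∣a , h∣b)

  β-modulus : ℕ → ℕ → ℕ
  β-modulus D i = suc (suc i * D)

  β-moduli-coprime : ∀ D i k → suc k ∣ D → Coprime (β-modulus D (i + suc k)) (β-modulus D i)
  β-moduli-coprime D i k 1+k∣D {g} (g∣mⱼ , g∣mᵢ) = ∣1⇒≡1 g∣1
    where
    j = i + suc k
    identity : suc i * β-modulus D j + suc k ≡ suc j * β-modulus D i
    identity = solve 3 (λ i k D → (con 1 :+ i) :* (con 1 :+ (con 1 :+ (i :+ (con 1 :+ k))) :* D) :+ (con 1 :+ k)
                            := (con 1 :+ (i :+ (con 1 :+ k))) :* (con 1 :+ (con 1 :+ i) :* D)) refl i k D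
    g∣1+k : g ∣ suc k
    g∣1+k = ∣m+n∣m⇒∣n (≡.subst (g ∣_) (sym identity) (∣-trans g∣mᵢ (n∣m*n (suc j)))) (∣-trans g∣mⱼ (n∣m*n (suc i)))
    g∣1 : g ∣ 1
    g∣1 = ∣m+n∣m⇒∣n (≡.subst (g ∣_) (+-comm 1 (suc i * D)) g∣mᵢ) (∣-trans (∣-trans g∣1+k 1+k∣D) (n∣m*n (suc i)))

  β-product : ℕ → ℕ → ℕ
  β-product D zero    = β-modulus D zero
  β-product D (suc x) = β-product D x * β-modulus D (suc x)

  β-modulus∣product : ∀ D x i → i ≤ x → β-modulus D i ∣ β-product D x
  β-modulus∣product D zero zero _ = ∣-refl
  β-modulus∣product D (suc x) i i≤1+x with m≤n⇒m<n∨m≡n i≤1+x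
  ... | inj₁ (s≤s i≤x) = ∣-trans (β-modulus∣product D x i i≤x) (m∣m*n (β-modulus D (suc x)))
  ... | inj₂ refl      = n∣m*n (β-product D x)

  β-modulus-coprime-product : ∀ D x → (∀ k → suc k ≤ suc x → suc k ∣ D) →
                              Coprime (β-modulus D (suc x)) (β-product D x)
  β-modulus-coprime-product D x small∣D = go x ≤-refl
    where
    go : ∀ y → y ≤ x → Coprime (β-modulus D (suc x)) (β-product D y)
    go zero _ = ≡.subst (λ j → Coprime (β-modulus D j) (β-modulus D 0)) (+-identityˡ (suc x))
                        (β-moduli-coprime D 0 x (small∣D x ≤-refl))
    go (suc y) 1+y≤x = coprime-* (go y (≤-trans (n≤1+n y) 1+y≤x)) coprime-last
      where
      k = x ∸ suc y
      index : suc y + suc k ≡ suc x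
      index = cong suc (≡.trans (+-suc y k) (m+[n∸m]≡n 1+y≤x))
      coprime-last : Coprime (β-modulus D (suc x)) (β-modulus D (suc y))
      coprime-last = ≡.subst (λ j → Coprime (β-modulus D j) (β-modulus D (suc y))) index
        (β-moduli-coprime D (suc y) k (small∣D k (≡.subst (suc k ≤_) index (m≤n+m (suc k) (suc y)))))

  chinese-remainder : ∀ x (z : ℕ → ℕ) D → (∀ k → suc k ≤ x → suc k ∣ D) →
                      Σ ℕ λ c → ∀ i → i ≤ x → c % β-modulus D i ≡ z i % β-modulus D i
  chinese-remainder zero z D _ = z 0 , λ { zero _ → refl }
  chinese-remainder (suc x) z D small∣D
    with chinese-remainder x z D (λ k k≤x → small∣D k (≤-trans k≤x (n≤1+n x)))
  ... | c₀ , c₀-solves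
    with inverse (β-product D x) (suc (suc x) * D) (Coprime.sym (β-modulus-coprime-product D x small∣D))
  ...   | e , Pe≡1 = c₀ + (β-product D x * e) * K , solves
    where
    -- K corrects the last residue; the factor β-product D x keeps the others.
    K = z (suc x) + suc (suc x) * D * c₀
    solves : ∀ i → i ≤ suc x → (c₀ + (β-product D x * e) * K) % β-modulus D i ≡ z i % β-modulus D i
    solves i i≤1+x with m≤n⇒m<n∨m≡n i≤1+x
    ... | inj₁ (s≤s i≤x) =
      ≡.trans (%-remove-+ʳ c₀ (∣-trans (β-modulus∣product D x i i≤x) (∣-trans (m∣m*n e) (m∣m*n K))))
              (c₀-solves i i≤x)
    ... | inj₂ refl = mod-eq⁻¹ (≡[]-trans (+-≡[] (≡[]-refl c₀) (*-≡[] Pe≡1 (≡[]-refl K)))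
                                          (≡[]-trans (≡⇒≡[] identity) (+multiple-≡[] (z (suc x)) c₀)))
      where
      identity : c₀ + 1 * K ≡ z (suc x) + c₀ * suc (suc (suc x) * D)
      identity = solve 3 (λ c z M → c :+ con 1 :* (z :+ M :* c) := z :+ c :* (con 1 :+ M))
                         refl c₀ (z (suc x)) (suc (suc x) * D)

  -- Taking D = x!·(1+Z)
  -- makes the moduli coprime and larger than every sᵢ.
  β-function-lemma : ∀ x (s : ℕ → ℕ) Z → (∀ i → i ≤ x → s i ≤ Z) →
                     Σ ℕ λ c → Σ ℕ λ D → Z ≤ D × (∀ i → i ≤ x → c % β-modulus D i ≡ s i)
  β-function-lemma x s Z s≤Z = c , D , Z≤D , decodes
    where
    D = x ! * suc Z
    Z≤D : Z ≤ D
    Z≤D = ≤-trans (n≤1+n Z) (m≤n*m (suc Z) (x !) {{x !≢0}})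
    1+k∣x! : ∀ k {x} → suc k ≤ x → suc k ∣ x !
    1+k∣x! k {x} 1+k≤x = ∣-trans (m∣m*n (k !)) (∣-trans (m∣m*n ((x ∸ suc k) !)) (k![n∸k]!∣n! 1+k≤x))
    solution = chinese-remainder x s D λ k 1+k≤x → ∣-trans (1+k∣x! k 1+k≤x) (m∣m*n (suc Z))
    c = proj₁ solution
    decodes : ∀ i → i ≤ x → c % β-modulus D i ≡ s i
    decodes i i≤x = ≡.trans (proj₂ solution i i≤x)
                            (m<n⇒m%n≡m (s≤s (≤-trans (s≤Z i i≤x) (≤-trans Z≤D (m≤n*m D (suc i))))))

module GraphFormula where

  -- G f has the variables (w, v, x⃗): it says that
  -- a computation of f on x⃗ with output v has a witness all of whose
  -- numbers are ≤ w.  Primitive recursion is coded by Gödel's β-function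
  -- β(c, d, i) = c mod (1 + (1+i)·d), the residue formula below.

  open Bounded
  open ChineseRemainder using (β-modulus)
  open import Data.Nat using (ℕ; zero; suc; _+_; _*_; _≤_; s≤s)
  open import Data.Nat.Properties using (+-comm; ≤-pred)
  open import Data.Nat.DivMod using (_%_; _/_; m%n<n; m/n≤m; m/n*n≤m; m≡m%n+[m/n]*n; [m+kn]%n≡m%n; m<n⇒m%n≡m)
  open import Data.Fin using (Fin; zero; suc; _↑ʳ_; _↑ˡ_)
  open import Data.Vec using (Vec; _∷_)
  open import Data.Product using (Σ; _×_; _,_)
  open import Function using (_∘_)
  open import Relation.Binary.PropositionalEquality as ≡ using (_≡_; refl; cong; sym)

  ⋀ : ∀ {n} m → (Fin m → D n) → D n
  ⋀ zero    F = pos (eqA `0 `0)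
  ⋀ (suc m) F = F zero ∧D ⋀ m (F ∘ suc)

  ⋀-⇒ : ∀ {n} m (F : Fin m → D n) ρ → ⟦ ⋀ m F ⟧ ρ → ∀ i → ⟦ F i ⟧ ρ
  ⋀-⇒ (suc m) F ρ (p , ps) zero    = p
  ⋀-⇒ (suc m) F ρ (p , ps) (suc i) = ⋀-⇒ m (F ∘ suc) ρ ps i

  ⋀-⇐ : ∀ {n} m (F : Fin m → D n) ρ → (∀ i → ⟦ F i ⟧ ρ) → ⟦ ⋀ m F ⟧ ρ
  ⋀-⇐ zero    F ρ h = refl
  ⋀-⇐ (suc m) F ρ h = h zero , ⋀-⇐ m (F ∘ suc) ρ (h ∘ suc)

  _++ₑ_ : ∀ {m n} → (Fin m → ℕ) → Env n → Env (m + n)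
  _++ₑ_ {zero}  ys ρ = ρ
  _++ₑ_ {suc m} ys ρ = ys zero ∷ₑ ((ys ∘ suc) ++ₑ ρ)

  ++ₑ-↑ʳ : ∀ {n} m (ys : Fin m → ℕ) (ρ : Env n) i → (ys ++ₑ ρ) (m ↑ʳ i) ≡ ρ i
  ++ₑ-↑ʳ zero    ys ρ i = refl
  ++ₑ-↑ʳ (suc m) ys ρ i = ++ₑ-↑ʳ m (ys ∘ suc) ρ i

  ++ₑ-↑ˡ : ∀ {n m} (ys : Fin m → ℕ) (ρ : Env n) j → (ys ++ₑ ρ) (j ↑ˡ n) ≡ ys j
  ++ₑ-↑ˡ ys ρ zero    = refl
  ++ₑ-↑ˡ ys ρ (suc j) = ++ₑ-↑ˡ (ys ∘ suc) ρ j

  ∃⃗ : ∀ {n} m → Fin n → D (m + n) → D n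
  ∃⃗ zero    b d = d
  ∃⃗ (suc m) b d = ∃⃗ m b (exD (m ↑ʳ b) d)

  ∃⃗-⇒ : ∀ {n} m b (d : D (m + n)) ρ → ⟦ ∃⃗ m b d ⟧ ρ →
         Σ (Fin m → ℕ) λ ys → (∀ i → ys i ≤ ρ b) × ⟦ d ⟧ (ys ++ₑ ρ)
  ∃⃗-⇒ zero b d ρ h = (λ ()) , (λ ()) , h
  ∃⃗-⇒ (suc m) b d ρ h with ∃⃗-⇒ m b (exD (m ↑ʳ b) d) ρ h
  ... | ys , ys≤b , (j , j≤b , holds) = (j ∷ₑ ys) , bounded , holds
    where
    bounded : ∀ i → (j ∷ₑ ys) i ≤ ρ b
    bounded zero    = ≡.subst (j ≤_) (++ₑ-↑ʳ m ys ρ b) j≤b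
    bounded (suc i) = ys≤b i

  ∃⃗-⇐ : ∀ {n} m b (d : D (m + n)) ρ (ys : Fin m → ℕ) → (∀ i → ys i ≤ ρ b) → ⟦ d ⟧ (ys ++ₑ ρ) → ⟦ ∃⃗ m b d ⟧ ρ
  ∃⃗-⇐ zero    b d ρ ys ys≤b h = h
  ∃⃗-⇐ (suc m) b d ρ ys ys≤b h =
    ∃⃗-⇐ m b (exD (m ↑ʳ b) d) ρ (ys ∘ suc) (ys≤b ∘ suc)
        (ys zero , ≡.subst (ys zero ≤_) (sym (++ₑ-↑ʳ m (ys ∘ suc) ρ b)) (ys≤b zero) , h)

  -- Residue c d t r w:  r = c mod (1 + (1+t)·d), i.e. r = β(c, d, t),
  -- with the auxiliary witnesses (1+t)·d, the quotient and the product
  -- bounded by w, c and c respectively.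
  Residue : ∀ {n} → Fin n → Fin n → Term n → Fin n → Fin n → D n
  Residue c d t r w =
    exD w (exD (suc c) (exD (suc (suc c))
      (pos (mulA (`S (renT below3 t)) (var (below3 d)) (var a)) ∧D
       pos (leA (var (below3 r)) (var a)) ∧D
       pos (mulA (var q) (`S (var a)) (var p)) ∧D
       pos (addA (var p) (var (below3 r)) (var (below3 c))))))
    where
    -- the witnesses a = (1+t)·d, q = c div (1+a), p = q·(1+a) are x₂, x₁, x₀
    below3 : ∀ {n} → Fin n → Fin (suc (suc (suc n)))
    below3 i = suc (suc (suc i))
    p = zero
    q = suc zero
    a = suc (suc zero)

  residue-sound : ∀ {n} c d t r w (ρ : Env n) → ⟦ Residue c d t r w ⟧ ρ →
                  ρ r ≡ ρ c % β-modulus (ρ d) (evT ρ t)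
  residue-sound c d t r w ρ (a , _ , q , _ , p , _ , [1+t]d≡a , r≤a , q[1+a]≡p , p+r≡c) =
    ≡.subst (λ A → ρ r ≡ ρ c % suc A) a≡[1+t]d (sym c%[1+a]≡r)
    where
    a≡[1+t]d : a ≡ suc (evT ρ t) * ρ d
    a≡[1+t]d = sym (≡.trans (cong (λ z → suc z * ρ d) (sym (evT-ren (λ _ → refl) t))) [1+t]d≡a)
    c≡r+q[1+a] : ρ c ≡ ρ r + q * suc a
    c≡r+q[1+a] = ≡.trans (sym p+r≡c) (≡.trans (cong (_+ ρ r) (sym q[1+a]≡p)) (+-comm (q * suc a) (ρ r)))
    c%[1+a]≡r : ρ c % suc a ≡ ρ r
    c%[1+a]≡r = ≡.trans (cong (_% suc a) c≡r+q[1+a])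
                        (≡.trans ([m+kn]%n≡m%n (ρ r) q (suc a)) (m<n⇒m%n≡m (s≤s r≤a)))

  residue-complete : ∀ {n} c d t r w (ρ : Env n) → ρ r ≡ ρ c % β-modulus (ρ d) (evT ρ t) →
                     suc (evT ρ t) * ρ d ≤ ρ w → ⟦ Residue c d t r w ⟧ ρ
  residue-complete c d t r w ρ r≡c%[1+a] a≤w =
    a , a≤w , q , m/n≤m (ρ c) (suc a) , p , m/n*n≤m (ρ c) (suc a) ,
    cong (λ z → suc z * ρ d) (evT-ren (λ _ → refl) t) ,
    ≡.subst (_≤ a) (sym r≡c%[1+a]) (≤-pred (m%n<n (ρ c) (suc a))) ,
    refl ,
    ≡.trans (cong (p +_) r≡c%[1+a]) (≡.trans (+-comm p (ρ c % suc a)) (sym (m≡m%n+[m/n]*n (ρ c) (suc a))))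
    where
    a = suc (evT ρ t) * ρ d
    q = ρ c / suc a
    p = q * suc a

  #v : (i : ℕ) → ∀ {n} → Fin (suc (i + n))
  #v zero    = zero
  #v (suc i) = suc (#v i)

  -- composition, context (y₁ … yₘ, w, v, x⃗): gᵢ gets (w, yᵢ, x⃗), f gets (w, v, y⃗)
  comp-arg : ∀ {k m} → Fin m → Fin (suc (suc k)) → Fin (m + suc (suc k))
  comp-arg {m = m} i zero          = m ↑ʳ zero
  comp-arg {k}     i (suc zero)    = i ↑ˡ suc (suc k)
  comp-arg {m = m} i (suc (suc j)) = m ↑ʳ suc (suc j)

  comp-outer : ∀ {k m} → Fin (suc (suc m)) → Fin (m + suc (suc k))
  comp-outer {m = m} zero          = m ↑ʳ zero
  comp-outer {m = m} (suc zero)    = m ↑ʳ suc zero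
  comp-outer {k}     (suc (suc j)) = j ↑ˡ suc (suc k)

  -- recursion, base: context (z, d, c, w, v, x, x⃗), f gets (w, z, x⃗)
  prec-base : ∀ {k} → Fin (suc (suc k)) → Fin (6 + k)
  prec-base zero          = #v 3
  prec-base (suc zero)    = #v 0
  prec-base (suc (suc j)) = 6 ↑ʳ j

  -- recursion, step: context (z′, z, i, d, c, w, v, x, x⃗), g gets (w, z′, i, z, x⃗)
  prec-step : ∀ {k} → Fin (4 + k) → Fin (8 + k)
  prec-step zero                      = #v 5
  prec-step (suc zero)                = #v 0
  prec-step (suc (suc zero))          = #v 2
  prec-step (suc (suc (suc zero)))    = #v 1
  prec-step (suc (suc (suc (suc j)))) = 8 ↑ʳ j

  -- minimisation, zero: context (o, w, v, x⃗), f gets (w, o, v, x⃗)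
  mu-zero : ∀ {k} → Fin (3 + k) → Fin (3 + k)
  mu-zero zero                = #v 1
  mu-zero (suc zero)          = #v 0
  mu-zero (suc (suc zero))    = #v 2
  mu-zero (suc (suc (suc j))) = 3 ↑ʳ j

  -- minimisation, below: context (o, t, z, w, v, x⃗), f gets (w, o, z, x⃗)
  mu-below : ∀ {k} → Fin (3 + k) → Fin (5 + k)
  mu-below zero                = #v 3
  mu-below (suc zero)          = #v 0
  mu-below (suc (suc zero))    = #v 2
  mu-below (suc (suc (suc j))) = 5 ↑ʳ j

  mutual
    G : ∀ {k} → PRec k → D (suc (suc k))
    G zeroF    = pos (eqA (var (#v 1)) `0)
    G succF    = pos (eqA (var (#v 1)) (`S (var (#v 2))))
    G (proj i) = pos (eqA (var (#v 1)) (var (suc (suc i))))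
    -- ∃ y⃗ ≤ w. ⋀ᵢ gᵢ(x⃗) = yᵢ ∧ f(y⃗) = v
    G (comp {m = m} f gs) = ∃⃗ m zero (⋀ m (λ i → renD (comp-arg i) (Gs gs i)) ∧D renD comp-outer (G f))
    -- ∃ c, d ≤ w. β(c,d,0) = f(x⃗) ∧ (∀ i ≤ x. i ≥ x ∨ β(c,d,i+1) = g(i, β(c,d,i), x⃗)) ∧ β(c,d,x) = v
    G (prec f g) = exD (#v 0) (exD (#v 1) (base ∧D step ∧D final))
      where
      final = Residue (#v 1) (#v 0) (var (#v 4)) (#v 3) (#v 2)
      base  = exD (#v 2) (Residue (#v 2) (#v 1) `0 (#v 0) (#v 3) ∧D renD prec-base (G f))
      step  = allD (#v 4) (pos (leA (var (#v 5)) (var (#v 0))) ∨D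
                exD (#v 3) (exD (#v 4) (Residue (#v 4) (#v 3) (var (#v 2)) (#v 1) (#v 5) ∧D
                                        Residue (#v 4) (#v 3) (`S (var (#v 2))) (#v 0) (#v 5) ∧D
                                        renD prec-step (G g))))
    -- f(v, x⃗) = 0 ∧ ∀ z ≤ v. z ≥ v ∨ ∃ t ≤ w. f(z, x⃗) = t+1
    G (mu f) = exD (#v 0) (pos (eqA (var (#v 0)) `0) ∧D renD mu-zero (G f)) ∧D
               allD (#v 1) (pos (leA (var (#v 2)) (var (#v 0))) ∨D
                            exD (#v 1) (exD (#v 2) (pos (eqA (var (#v 0)) (`S (var (#v 1)))) ∧D
                                                    renD mu-below (G f))))

    Gs : ∀ {k m} → Vec (PRec k) m → Fin m → D (suc (suc k))
    Gs (g ∷ gs) zero    = G g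
    Gs (g ∷ gs) (suc i) = Gs gs i

  Graph : ∀ {k} → PRec k → ℕ → ℕ → Vec ℕ k → Set
  Graph f w v xs = ⟦ G f ⟧ (w ∷ₑ v ∷ₑ lookupV xs)

  comp-arg-≗ : ∀ {k m} (ys : Fin m → ℕ) (ρ : Env (suc (suc k))) i →
               ((ys ++ₑ ρ) ∘ comp-arg i) ≗ (ρ zero ∷ₑ ys i ∷ₑ λ j → ρ (suc (suc j)))
  comp-arg-≗ {m = m} ys ρ i zero          = ++ₑ-↑ʳ m ys ρ zero
  comp-arg-≗         ys ρ i (suc zero)    = ++ₑ-↑ˡ ys ρ i
  comp-arg-≗ {m = m} ys ρ i (suc (suc j)) = ++ₑ-↑ʳ m ys ρ (suc (suc j))

  comp-outer-≗ : ∀ {k m} (ys : Fin m → ℕ) (ρ : Env (suc (suc k))) {ys′ : Env m} → ys ≗ ys′ →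
                 ((ys ++ₑ ρ) ∘ comp-outer) ≗ (ρ zero ∷ₑ ρ (suc zero) ∷ₑ ys′)
  comp-outer-≗ {m = m} ys ρ e zero          = ++ₑ-↑ʳ m ys ρ zero
  comp-outer-≗ {m = m} ys ρ e (suc zero)    = ++ₑ-↑ʳ m ys ρ (suc zero)
  comp-outer-≗         ys ρ e (suc (suc j)) = ≡.trans (++ₑ-↑ˡ ys ρ j) (e j)

  prec-base-≗ : ∀ {k} z d c w v x (xs : Vec ℕ k) →
                ((z ∷ₑ d ∷ₑ c ∷ₑ w ∷ₑ v ∷ₑ lookupV (x ∷ xs)) ∘ prec-base) ≗ (w ∷ₑ z ∷ₑ lookupV xs)
  prec-base-≗ z d c w v x xs zero          = refl
  prec-base-≗ z d c w v x xs (suc zero)    = refl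
  prec-base-≗ z d c w v x xs (suc (suc j)) = refl

  prec-step-≗ : ∀ {k} z′ z i d c w v x (xs : Vec ℕ k) →
                ((z′ ∷ₑ z ∷ₑ i ∷ₑ d ∷ₑ c ∷ₑ w ∷ₑ v ∷ₑ lookupV (x ∷ xs)) ∘ prec-step) ≗
                (w ∷ₑ z′ ∷ₑ lookupV (i ∷ z ∷ xs))
  prec-step-≗ z′ z i d c w v x xs zero                      = refl
  prec-step-≗ z′ z i d c w v x xs (suc zero)                = refl
  prec-step-≗ z′ z i d c w v x xs (suc (suc zero))          = refl
  prec-step-≗ z′ z i d c w v x xs (suc (suc (suc zero)))    = refl
  prec-step-≗ z′ z i d c w v x xs (suc (suc (suc (suc j)))) = refl

  mu-zero-≗ : ∀ {k} o w v (xs : Vec ℕ k) →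
              ((o ∷ₑ w ∷ₑ v ∷ₑ lookupV xs) ∘ mu-zero) ≗ (w ∷ₑ o ∷ₑ lookupV (v ∷ xs))
  mu-zero-≗ o w v xs zero                = refl
  mu-zero-≗ o w v xs (suc zero)          = refl
  mu-zero-≗ o w v xs (suc (suc zero))    = refl
  mu-zero-≗ o w v xs (suc (suc (suc j))) = refl

  mu-below-≗ : ∀ {k} o t z w v (xs : Vec ℕ k) →
               ((o ∷ₑ t ∷ₑ z ∷ₑ w ∷ₑ v ∷ₑ lookupV xs) ∘ mu-below) ≗ (w ∷ₑ o ∷ₑ lookupV (z ∷ xs))
  mu-below-≗ o t z w v xs zero                = refl
  mu-below-≗ o t z w v xs (suc zero)          = refl
  mu-below-≗ o t z w v xs (suc (suc zero))    = refl
  mu-below-≗ o t z w v xs (suc (suc (suc j))) = refl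

module GraphSoundness where

  open Bounded
  open GraphFormula
  open ChineseRemainder using (β-modulus)
  open import Data.Nat using (ℕ; zero; suc; _≤_; _<_; _%_)
  open import Data.Nat.Properties using (≤-refl; ≤-trans; n≤1+n; <⇒≤; ≤⇒≯)
  open import Data.Fin using (Fin; zero; suc)
  open import Data.Vec using (Vec; []; _∷_; tabulate)
  open import Data.Product using (_,_; ∃)
  open import Data.Sum using (inj₁; inj₂)
  open import Data.Empty using (⊥-elim)
  open import Function using (_∘_; Equivalence)
  open import Relation.Binary.PropositionalEquality as ≡ using (_≡_; refl; sym)
  open Equivalence using (to)

  GraphSound : ∀ {k} → PRec k → Set
  GraphSound f = ∀ {xs w v} → Graph f w v xs → f ⟨ xs ⟩⇓ v

  GraphsSound : ∀ {k m} → Vec (PRec k) m → Set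
  GraphsSound gs = ∀ {xs w} ys → (∀ i → ⟦ Gs gs i ⟧ (w ∷ₑ lookupV ys i ∷ₑ lookupV xs)) → gs ⟨ xs ⟩⇓* ys

  lookup-tabulate : ∀ {m} (ys : Fin m → ℕ) i → lookupV (tabulate ys) i ≡ ys i
  lookup-tabulate ys zero    = refl
  lookup-tabulate ys (suc i) = lookup-tabulate (ys ∘ suc) i

  comp-sound : ∀ {k m} {f : PRec m} {gs : Vec (PRec k) m} → GraphSound f → GraphsSound gs → GraphSound (comp f gs)
  comp-sound {m = m} {f} {gs} f-sound gs-sound {xs} {w} {v} holds
    with ∃⃗-⇒ m zero _ (w ∷ₑ v ∷ₑ lookupV xs) holds
  ... | ys , _ , (args , outer) =
    e-comp (gs-sound (tabulate ys) arg)
           (f-sound (to (⟦renD⟧ (comp-outer-≗ ys _ (sym ∘ lookup-tabulate ys)) (G f)) outer))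
    where
    arg : ∀ i → ⟦ Gs gs i ⟧ (w ∷ₑ lookupV (tabulate ys) i ∷ₑ lookupV xs)
    arg i = ≡.subst (λ y → ⟦ Gs gs i ⟧ (w ∷ₑ y ∷ₑ lookupV xs)) (sym (lookup-tabulate ys i))
                    (to (⟦renD⟧ (comp-arg-≗ ys _ i) (Gs gs i)) (⋀-⇒ m _ _ args i))

  -- The witnesses c, d code the whole trace β(c,d,0), …, β(c,d,x); each
  -- entry is shown to be the value of the recursion by induction.
  prec-sound : ∀ {k} {f : PRec k} {g : PRec (suc (suc k))} → GraphSound f → GraphSound g → GraphSound (prec f g)
  prec-sound {f = f} {g} f-sound g-sound {x ∷ xs} {w} {v} (c , _ , d , _ , base , step , final) =
    ≡.subst (prec f g ⟨ x ∷ xs ⟩⇓_) (sym v≡βx) (trace x ≤-refl)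
    where
    ρ = d ∷ₑ c ∷ₑ w ∷ₑ v ∷ₑ lookupV (x ∷ xs)
    β : ℕ → ℕ
    β i = c % β-modulus d i
    v≡βx : v ≡ β x
    v≡βx = residue-sound (#v 1) (#v 0) (var (#v 4)) (#v 3) (#v 2) ρ final
    trace : ∀ i → i ≤ x → prec f g ⟨ i ∷ xs ⟩⇓ β i
    trace zero _ = let (z , _ , z≡β0 , f-holds) = base in
      ≡.subst (prec f g ⟨ 0 ∷ xs ⟩⇓_) (residue-sound (#v 2) (#v 1) `0 (#v 0) (#v 3) (z ∷ₑ ρ) z≡β0)
              (e-prec0 (f-sound (to (⟦renD⟧ (prec-base-≗ z d c w v x xs) (G f)) f-holds)))
    trace (suc i) 1+i≤x with step i (≤-trans (n≤1+n i) 1+i≤x)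
    ... | inj₁ x≤i = ⊥-elim (≤⇒≯ x≤i 1+i≤x)
    ... | inj₂ (z , _ , z′ , _ , z≡βi , z′≡β1+i , g-holds) =
      ≡.subst (prec f g ⟨ suc i ∷ xs ⟩⇓_) (residue-sound (#v 4) (#v 3) (`S (var (#v 2))) (#v 0) (#v 5) ρ′ z′≡β1+i)
              (e-precS (≡.subst (prec f g ⟨ i ∷ xs ⟩⇓_)
                                (sym (residue-sound (#v 4) (#v 3) (var (#v 2)) (#v 1) (#v 5) ρ′ z≡βi))
                                (trace i (≤-trans (n≤1+n i) 1+i≤x)))
                       (g-sound (to (⟦renD⟧ (prec-step-≗ z′ z i d c w v x xs) (G g)) g-holds)))
      where
      ρ′ = z′ ∷ₑ z ∷ₑ i ∷ₑ ρ

  mu-sound : ∀ {k} {f : PRec (suc k)} → GraphSound f → GraphSound (mu f)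
  mu-sound {f = f} f-sound {xs} {w} {v} ((o , _ , o≡0 , zero-holds) , below) =
    e-mu (≡.subst (f ⟨ v ∷ xs ⟩⇓_) o≡0 (f-sound (to (⟦renD⟧ (mu-zero-≗ o w v xs) (G f)) zero-holds)))
         positive-below
    where
    positive-below : ∀ z → z < v → ∃ λ t → f ⟨ z ∷ xs ⟩⇓ suc t
    positive-below z z<v with below z (<⇒≤ z<v)
    ... | inj₁ v≤z = ⊥-elim (≤⇒≯ v≤z z<v)
    ... | inj₂ (t , _ , o′ , _ , o′≡1+t , f-holds) =
      t , ≡.subst (f ⟨ z ∷ xs ⟩⇓_) o′≡1+t (f-sound (to (⟦renD⟧ (mu-below-≗ o′ t z w v xs) (G f)) f-holds))

  mutual
    graph-sound : ∀ {k} (f : PRec k) → GraphSound f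
    graph-sound zeroF refl              = e-zero
    graph-sound succF {x ∷ []} refl     = e-succ
    graph-sound (proj i) refl           = e-proj i
    graph-sound (comp f gs)             = comp-sound (graph-sound f) (graphs-sound gs)
    graph-sound (prec f g)              = prec-sound (graph-sound f) (graph-sound g)
    graph-sound (mu f)                  = mu-sound (graph-sound f)

    graphs-sound : ∀ {k m} (gs : Vec (PRec k) m) → GraphsSound gs
    graphs-sound []       []       _     = []
    graphs-sound (g ∷ gs) (y ∷ ys) holds = graph-sound g (holds zero) ∷ graphs-sound gs ys (holds ∘ suc)

module GraphCompleteness where

  open Bounded
  open GraphFormula
  open ChineseRemainder using (β-modulus; β-function-lemma)
  open import Data.Nat using (ℕ; zero; suc; _*_; _%_; _≤_; _<_; _⊔_; z≤n; s≤s; _≟_; _≤?_)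
  open import Data.Nat.Properties
  open import Data.Fin using (Fin; zero; suc)
  open import Data.Vec using (Vec; []; _∷_)
  open import Data.Product using (Σ; _×_; _,_; proj₁; proj₂; ∃)
  open import Data.Sum using (inj₁; inj₂)
  open import Data.Empty using (⊥-elim)
  open import Function using (_∘_; Equivalence)
  open import Relation.Nullary using (¬_; yes; no)
  open import Relation.Binary.PropositionalEquality as ≡ using (_≡_; refl; sym)
  open Equivalence using (from)

  Eventually : (ℕ → Set) → Set
  Eventually P = Σ ℕ λ W → ∀ w → W ≤ w → P w

  eventually-≥ : ∀ n → Eventually (n ≤_)
  eventually-≥ n = n , λ w n≤w → n≤w

  eventually-map : ∀ {P Q : ℕ → Set} → (∀ {w} → P w → Q w) → Eventually P → Eventually Q
  eventually-map f (W , h) = W , λ w W≤w → f (h w W≤w)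

  eventually-× : ∀ {P Q : ℕ → Set} → Eventually P → Eventually Q → Eventually (λ w → P w × Q w)
  eventually-× (W , p) (W′ , q) = W ⊔ W′ , λ w le → p w (m⊔n≤o⇒m≤o W W′ le) , q w (m⊔n≤o⇒n≤o W W′ le)

  eventually-∀Fin : ∀ m {P : Fin m → ℕ → Set} → (∀ i → Eventually (P i)) → Eventually (λ w → ∀ i → P i w)
  eventually-∀Fin zero    h = 0 , λ w _ ()
  eventually-∀Fin (suc m) h =
    eventually-map (λ { (p₀ , ps) zero → p₀ ; (p₀ , ps) (suc i) → ps i })
                   (eventually-× (h zero) (eventually-∀Fin m (h ∘ suc)))

  eventually-∀< : ∀ n {P : ℕ → ℕ → Set} → (∀ z → z < n → Eventually (P z)) →
                  Eventually (λ w → ∀ z → z < n → P z w)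
  eventually-∀< zero    h = 0 , λ w _ z ()
  eventually-∀< (suc n) {P} h =
    eventually-map combine (eventually-× (h n ≤-refl) (eventually-∀< n λ z z<n → h z (m≤n⇒m≤1+n z<n)))
    where
    combine : ∀ {w} → P n w × (∀ z → z < n → P z w) → ∀ z → z < suc n → P z w
    combine (pₙ , ps) z z<1+n with m≤n⇒m<n∨m≡n (≤-pred z<1+n)
    ... | inj₁ z<n = ps z z<n
    ... | inj₂ refl = pₙ

  GraphComplete : ∀ {k} → PRec k → Set
  GraphComplete f = ∀ {xs v} → f ⟨ xs ⟩⇓ v → Eventually (λ w → Graph f w v xs)

  GraphsComplete : ∀ {k m} → Vec (PRec k) m → Set
  GraphsComplete gs = ∀ {xs ys} → gs ⟨ xs ⟩⇓* ys →
                      Eventually (λ w → ∀ i → ⟦ Gs gs i ⟧ (w ∷ₑ lookupV ys i ∷ₑ lookupV xs))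

  comp-complete : ∀ {k m} {f : PRec m} {gs : Vec (PRec k) m} → GraphComplete f → GraphsComplete gs →
                  GraphComplete (comp f gs)
  comp-complete {m = m} {f} {gs} f-complete gs-complete {xs} {v} (e-comp {ys = ys} args outer) =
    eventually-map build
      (eventually-× (gs-complete args)
                    (eventually-× (f-complete outer) (eventually-∀Fin m (eventually-≥ ∘ lookupV ys))))
    where
    build : ∀ {w} → _ → Graph (comp f gs) w v xs
    build (args-hold , outer-holds , ys≤w) =
      ∃⃗-⇐ m zero _ _ (lookupV ys) ys≤w
          (⋀-⇐ m _ _ (λ i → from (⟦renD⟧ (comp-arg-≗ (lookupV ys) _ i) (Gs gs i)) (args-hold i)) ,
           from (⟦renD⟧ (comp-outer-≗ (lookupV ys) _ (λ _ → refl)) (G f)) outer-holds)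

  mu-complete : ∀ {k} {f : PRec (suc k)} → GraphComplete f → GraphComplete (mu f)
  mu-complete {f = f} f-complete {xs} {v} (e-mu zero-at-v positive-below) =
    eventually-map build (eventually-× (f-complete zero-at-v) (eventually-∀< v below))
    where
    Below : ℕ → ℕ → Set
    Below z w = ∃ λ t → suc t ≤ w × Graph f w (suc t) (z ∷ xs)
    below : ∀ z → z < v → Eventually (Below z)
    below z z<v = let (t , computes) = positive-below z z<v in
      eventually-map (λ { (1+t≤w , holds) → t , 1+t≤w , holds })
                     (eventually-× (eventually-≥ (suc t)) (f-complete computes))
    build : ∀ {w} → Graph f w 0 (v ∷ xs) × (∀ z → z < v → Below z w) → Graph (mu f) w v xs
    build {w} (zero-holds , below-hold) =
      (0 , z≤n , refl , from (⟦renD⟧ (mu-zero-≗ 0 w v xs) (G f)) zero-holds) , case-z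
      where
      case-z : ∀ z → z ≤ v → _
      case-z z z≤v with v ≤? z
      ... | yes v≤z = inj₁ v≤z
      ... | no  v≰z = let (t , 1+t≤w , holds) = below-hold z (≰⇒> v≰z) in
        inj₂ (t , ≤-trans (n≤1+n t) 1+t≤w , suc t , 1+t≤w , refl ,
              from (⟦renD⟧ (mu-below-≗ (suc t) t z w v xs) (G f)) holds)

  record PrecTrace {k} (f : PRec k) (g : PRec (suc (suc k))) (x : ℕ) (xs : Vec ℕ k) (v : ℕ) : Set where
    field
      value       : ℕ → ℕ
      value-last  : value x ≡ v
      base        : Eventually (λ w → Graph f w (value 0) xs)
      steps       : Eventually (λ w → ∀ i → i < x → Graph g w (value (suc i)) (i ∷ value i ∷ xs))
      bound       : ℕ
      value≤bound : ∀ i → i ≤ x → value i ≤ bound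

  update : (ℕ → ℕ) → ℕ → ℕ → ℕ → ℕ
  update s k y i with i ≟ k
  ... | yes _ = y
  ... | no  _ = s i

  update-here : ∀ s k y → update s k y k ≡ y
  update-here s k y with k ≟ k
  ... | yes _   = refl
  ... | no  k≢k = ⊥-elim (k≢k refl)

  update-elsewhere : ∀ s k y i → ¬ (i ≡ k) → update s k y i ≡ s i
  update-elsewhere s k y i i≢k with i ≟ k
  ... | yes i≡k = ⊥-elim (i≢k i≡k)
  ... | no  _   = refl

  prec-trace : ∀ {k} {f : PRec k} {g : PRec (suc (suc k))} → GraphComplete f → GraphComplete g →
               ∀ {x xs v} → prec f g ⟨ x ∷ xs ⟩⇓ v → PrecTrace f g x xs v
  prec-trace f-complete g-complete {v = v} (e-prec0 computes) = record
    { value = λ _ → v ; value-last = refl ; base = f-complete computes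
    ; steps = 0 , (λ w _ i ()) ; bound = v ; value≤bound = λ _ _ → ≤-refl }
  prec-trace {f = f} {g} f-complete g-complete {xs = xs} (e-precS {x = x} {z = z} {y = y} earlier last) = record
    { value = value ; value-last = update-here T.value (suc x) y
    ; base = eventually-map (λ {w} → ≡.subst (λ z → Graph f w z xs) (sym (old 0 z≤n))) T.base
    ; steps = eventually-map extend-steps (eventually-× T.steps (g-complete last))
    ; bound = T.bound ⊔ y ; value≤bound = value≤bound }
    where
    module T = PrecTrace (prec-trace f-complete g-complete earlier)
    value = update T.value (suc x) y
    old : ∀ i → i ≤ x → value i ≡ T.value i
    old i i≤x = update-elsewhere _ (suc x) y i (<⇒≢ (s≤s i≤x))
    extend-steps : ∀ {w} → (∀ i → i < x → Graph g w (T.value (suc i)) (i ∷ T.value i ∷ xs)) ×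
                           Graph g w y (x ∷ z ∷ xs) → ∀ i → i < suc x → Graph g w (value (suc i)) (i ∷ value i ∷ xs)
    extend-steps {w} (old-steps , last-step) i (s≤s i≤x) with m≤n⇒m<n∨m≡n i≤x
    ... | inj₁ i<x  = ≡.subst₂ (λ a b → Graph g w a (i ∷ b ∷ xs)) (sym (old (suc i) i<x)) (sym (old i i≤x))
                               (old-steps i i<x)
    ... | inj₂ refl = ≡.subst₂ (λ a b → Graph g w a (i ∷ b ∷ xs)) (sym (update-here _ (suc x) y))
                               (sym (≡.trans (old x ≤-refl) T.value-last)) last-step
    value≤bound : ∀ i → i ≤ suc x → value i ≤ T.bound ⊔ y
    value≤bound i i≤1+x with m≤n⇒m<n∨m≡n i≤1+x
    ... | inj₁ (s≤s i≤x) = ≡.subst (_≤ T.bound ⊔ y) (sym (old i i≤x)) (≤-trans (T.value≤bound i i≤x) (m≤m⊔n _ _))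
    ... | inj₂ refl      = ≡.subst (_≤ T.bound ⊔ y) (sym (update-here _ (suc x) y)) (m≤n⊔m _ _)

  -- The trace is coded by c, D via the β-function; all witnesses of the
  -- graph formula are then bounded by max(c, (1+x)·D) and the bounds of
  -- the sub-computations.
  prec-complete : ∀ {k} {f : PRec k} {g : PRec (suc (suc k))} → GraphComplete f → GraphComplete g →
                  GraphComplete (prec f g)
  prec-complete {f = f} {g} f-complete g-complete {x ∷ xs} {v} computes =
    eventually-map build
      (eventually-× (eventually-≥ c) (eventually-× (eventually-≥ (suc x * d)) (eventually-× T.base T.steps)))
    where
    module T = PrecTrace (prec-trace f-complete g-complete computes)
    coding = β-function-lemma x T.value T.bound T.value≤bound
    c = proj₁ coding
    d = proj₁ (proj₂ coding)
    bound≤d = proj₁ (proj₂ (proj₂ coding))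
    decodes : ∀ i → i ≤ x → c % β-modulus d i ≡ T.value i
    decodes = proj₂ (proj₂ (proj₂ coding))
    build : ∀ {w} → c ≤ w × suc x * d ≤ w × Graph f w (T.value 0) xs ×
            (∀ i → i < x → Graph g w (T.value (suc i)) (i ∷ T.value i ∷ xs)) → Graph (prec f g) w v (x ∷ xs)
    build {w} (c≤w , [1+x]d≤w , base-holds , steps-hold) = c , c≤w , d , d≤w , base , step , final
      where
      d≤w : d ≤ w
      d≤w = ≤-trans (m≤n*m d (suc x)) [1+x]d≤w
      [1+i]d≤w : ∀ i → i ≤ x → suc i * d ≤ w
      [1+i]d≤w i i≤x = ≤-trans (*-monoˡ-≤ d (s≤s i≤x)) [1+x]d≤w
      value≤w : ∀ i → i ≤ x → T.value i ≤ w
      value≤w i i≤x = ≤-trans (T.value≤bound i i≤x) (≤-trans bound≤d d≤w)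
      ρ = d ∷ₑ c ∷ₑ w ∷ₑ v ∷ₑ lookupV (x ∷ xs)
      base = T.value 0 , value≤w 0 z≤n ,
             residue-complete (#v 2) (#v 1) `0 (#v 0) (#v 3) (T.value 0 ∷ₑ ρ) (sym (decodes 0 z≤n)) ([1+i]d≤w 0 z≤n) ,
             from (⟦renD⟧ (prec-base-≗ (T.value 0) d c w v x xs) (G f)) base-holds
      step : ∀ i → i ≤ x → _
      step i i≤x with x ≤? i
      ... | yes x≤i = inj₁ x≤i
      ... | no  x≰i =
        inj₂ (T.value i , value≤w i i≤x , T.value (suc i) , value≤w (suc i) 1+i≤x ,
              residue-complete (#v 4) (#v 3) (var (#v 2)) (#v 1) (#v 5) ρ′ (sym (decodes i i≤x)) ([1+i]d≤w i i≤x) ,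
              residue-complete (#v 4) (#v 3) (`S (var (#v 2))) (#v 0) (#v 5) ρ′
                               (sym (decodes (suc i) 1+i≤x)) ([1+i]d≤w (suc i) 1+i≤x) ,
              from (⟦renD⟧ (prec-step-≗ (T.value (suc i)) (T.value i) i d c w v x xs) (G g)) (steps-hold i 1+i≤x))
        where
        1+i≤x = ≰⇒> x≰i
        ρ′ = T.value (suc i) ∷ₑ T.value i ∷ₑ i ∷ₑ ρ
      final = residue-complete (#v 1) (#v 0) (var (#v 4)) (#v 3) (#v 2) ρ
                               (≡.trans (sym T.value-last) (sym (decodes x ≤-refl))) ([1+i]d≤w x ≤-refl)

  mutual
    graph-complete : ∀ {k} (f : PRec k) → GraphComplete f
    graph-complete zeroF    e-zero     = eventually-map (λ _ → refl) (eventually-≥ 0)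
    graph-complete succF    e-succ     = eventually-map (λ _ → refl) (eventually-≥ 0)
    graph-complete (proj i) (e-proj i) = eventually-map (λ _ → refl) (eventually-≥ 0)
    graph-complete (comp f gs)         = comp-complete (graph-complete f) (graphs-complete gs)
    graph-complete (prec f g)          = prec-complete (graph-complete f) (graph-complete g)
    graph-complete (mu f)              = mu-complete (graph-complete f)

    graphs-complete : ∀ {k m} (gs : Vec (PRec k) m) → GraphsComplete gs
    graphs-complete []       []               = 0 , λ w _ ()
    graphs-complete (g ∷ gs) (first ∷ others) =
      eventually-map (λ { (h , hs) zero → h ; (h , hs) (suc i) → hs i })
                     (eventually-× (graph-complete g first) (graphs-complete gs others))

module Rosser where

  -- Let θA(c, n), θB(c, n) be Δ₀ (variables x₀ = c, x₁ = n).
  -- The Σ₁-formula  φ(n) = ∃c. θA(c, n) ∧ ¬∃c′ ≤ c. θB(c′, n)  is proved by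
  -- R∽ at n̄ whenever θA(c, n) holds for some c and θB(·, n) never holds,
  -- and refuted whenever θB(m, n) holds for some m and θA(·, n) never holds:
  -- in the latter case R∽ proves θA(x, n̄) → ∃c′ ≤ x. θB(c′, n̄) by splitting
  -- on x ≤ m̄ ∨ m̄ ≤ x.

  open Substitution
  open Derivations
  open Bounded
  open Δ₀Completeness
  open import Data.Nat using (ℕ; zero; suc)
  open import Data.Fin using (Fin; zero; suc)
  open import Data.Product using (_,_; proj₁; proj₂)
  open import Function using (_∘_; Equivalence)
  open import Relation.Nullary using (¬_)
  open import Relation.Binary.PropositionalEquality as ≡ using (_≡_; refl; cong; sym)

  module _ (θA θB : D 2) where

    -- ∃c′ ≤ c. θB(c′, n), in the context (c, n)
    θB-below : D 2
    θB-below = exD zero (renD keep-n θB)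
      where
      keep-n : Fin 2 → Fin 3
      keep-n zero    = zero
      keep-n (suc i) = suc (suc i)

    rosser-matrix : Formula 2
    rosser-matrix = ¬' (⌜ θB-below ⌝ ∨' ¬' ⌜ θA ⌝)

    rosser-formula : Formula 1
    rosser-formula = ∃' rosser-matrix

    rosser-Σ₁ : Σ₁ rosser-formula
    rosser-Σ₁ = sig (imp (or (⌜⌝-Δ₀ θB-below) (imp (⌜⌝-Δ₀ θA) bot)) bot)

    module AtArgument (n : ℕ) where
      σ : Fin 2 → Term 1
      σ = lift (sub0 (num n))

      represents-n : Represents ⟨ n ⟩ (sub0 (num n))
      represents-n zero = refl

      decided : ∀ {k} (d : D 2) (τ : Fin 1 → Term k) {j} → τ zero ≡ num j →
                Decides (⟦ d ⟧ (j ، n)) (subst τ (subst σ ⌜ d ⌝))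
      decided d τ = Δ₀-complete-under d ⟨ n ⟩ (sub0 (num n)) represents-n τ

    rosser-proves : ∀ n c → ⟦ θA ⟧ (c ، n) → (∀ c′ → ¬ ⟦ θB ⟧ (c′ ، n)) → R∽⊢ rosser-formula [ num n ]
    rosser-proves n c θA-holds θB-never =
      mp (∨-e (proj₂ (decided θB-below (sub0 (num c)) refl) no-θB-below)
              (app `⊥ (proj₁ (decided θA (sub0 (num c)) refl) θA-holds)))
         (∃-i _ (num c))
      where
      open AtArgument n
      no-θB-below : ¬ ⟦ θB-below ⟧ (c ، n)
      no-θB-below (c′ , _ , holds) =
        θB-never c′ (Equivalence.to (⟦renD⟧ (λ { zero → refl ; (suc zero) → refl }) θB) holds)

    rosser-refutes : ∀ n m → ⟦ θB ⟧ (m ، n) → (∀ c → ¬ ⟦ θA ⟧ (c ، n)) → R∽⊢ ¬' (rosser-formula [ num n ])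
    rosser-refutes n m θB-holds θA-never =
      ∃-e (app `⊥ (mp (nonlog (ax-tot zero m)) (∨-e (trans x≤m⇒¬θA (∨-i₂ _ _)) (trans m≤x⇒θB-below (∨-i₁ _ _)))))
      where
      open AtArgument n
      x≤m⇒¬θA : R∽⊢ (var zero ≼ num m) ⇒ ¬' (subst σ ⌜ θA ⌝)
      x≤m⇒¬θA = ≼-bounded m _ λ j _ → proj₂ (decided θA (fix₀ j) refl) (θA-never j)
      -- θB(m̄, n̄) as the matrix of θB-below at c′ := m̄
      θB-at-m : R∽⊢ (subst (lift σ) ⌜ renD _ θB ⌝) [ num m ]
      θB-at-m = ⊢-cast (sym (≡.trans (cong (λ X → subst (lift σ) X [ num m ]) (⌜renD⌝ _ θB))
                                     (≡.trans (subst-fuse (sub0 (num m)) (lift σ) _)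
                                              (subst-fuse (substT (sub0 (num m)) ∘ lift σ) _ ⌜ θB ⌝))))
                       (proj₁ (Δ₀-complete θB (m ، n) _ represents) θB-holds)
        where
        represents : Represents (m ، n) _
        represents zero       = refl
        represents (suc zero) = ≡.trans (cong (substT (sub0 (num m)))
                                              (≡.trans (cong (renT suc) (renT-num suc n)) (renT-num suc n)))
                                        (substT-num _ n)
      m≤x⇒θB-below : R∽⊢ (num m ≼ var zero) ⇒ subst σ ⌜ θB-below ⌝
      m≤x⇒θB-below = trans (∧-i (id-ax _) (weak _ θB-at-m)) (∃-i _ (num m))

module Halting where

  -- Halts f (c, n): f halts on n with a computation bounded by c, that is,
  -- ∃ v ≤ c. G f (c, v, n).  Inside the quantifier the context is (v, c, n).
  -- G f has the context (w, v, n); here w := c and v := the quantified x₀.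

  open Bounded
  open GraphFormula
  open GraphSoundness
  open GraphCompleteness
  open import Data.Nat using (ℕ; zero; suc; _⊔_)
  open import Data.Nat.Properties using (m≤m⊔n; m≤n⊔m)
  open import Data.Fin using (Fin; zero; suc)
  open import Data.Vec using ([]; _∷_)
  open import Data.Product using (Σ; _,_; proj₁; proj₂; ∃)
  open import Function using (_∘_; Equivalence)
  open Equivalence using (to; from)
  open import Relation.Binary.PropositionalEquality using (refl)

  halts-place : Fin 3 → Fin 3
  halts-place zero             = suc zero
  halts-place (suc zero)       = zero
  halts-place (suc (suc zero)) = suc (suc zero)

  Halts : PRec 1 → D 2
  Halts f = exD zero (renD halts-place (G f))

  halts-place-≗ : ∀ v c n → ((v ∷ₑ c ، n) ∘ halts-place) ≗ (c ∷ₑ v ∷ₑ lookupV (n ∷ []))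
  halts-place-≗ v c n zero             = refl
  halts-place-≗ v c n (suc zero)       = refl
  halts-place-≗ v c n (suc (suc zero)) = refl

  halts-sound : ∀ f n c → ⟦ Halts f ⟧ (c ، n) → ∃ λ v → f ⟨ n ∷ [] ⟩⇓ v
  halts-sound f n c (v , _ , holds) = v , graph-sound f (to (⟦renD⟧ (halts-place-≗ v c n) (G f)) holds)

  halts-complete : ∀ f n → (∃ λ v → f ⟨ n ∷ [] ⟩⇓ v) → Σ ℕ λ c → ⟦ Halts f ⟧ (c ، n)
  halts-complete f n (v , computes) =
    W ⊔ v , v , m≤n⊔m W v , from (⟦renD⟧ (halts-place-≗ v (W ⊔ v) n) (G f)) (eventually (W ⊔ v) (m≤m⊔n W v))
    where
    W = proj₁ (graph-complete f computes)
    eventually = proj₂ (graph-complete f computes)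

open Halting
open Rosser

mainTheorem9 : (A B : ℕ → Set) → RE A → RE B → Disjoint A B →
    Σ (Formula 1) λ φ → Σ₁ φ
    × (∀ n → A n → R∽⊢ φ [ num n ])
    × (∀ n → B n → R∽⊢ ¬' (φ [ num n ]))
mainTheorem9 A B (f , A-domain) (g , B-domain) disjoint =
  rosser-formula (Halts f) (Halts g) , rosser-Σ₁ (Halts f) (Halts g) , proves , refutes
  where
  proves : ∀ n → A n → R∽⊢ rosser-formula (Halts f) (Halts g) [ num n ]
  proves n n∈A = let (c , halts) = halts-complete f n (proj₁ (A-domain n) n∈A) in
    rosser-proves (Halts f) (Halts g) n c halts
      λ c′ halts′ → disjoint n n∈A (proj₂ (B-domain n) (halts-sound g n c′ halts′))
  refutes : ∀ n → B n → R∽⊢ ¬' (rosser-formula (Halts f) (Halts g) [ num n ])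
  refutes n n∈B = let (m , halts) = halts-complete g n (proj₁ (B-domain n) n∈B) in
    rosser-refutes (Halts f) (Halts g) n m halts
      λ c halts′ → disjoint n (proj₂ (A-domain n) (halts-sound f n c halts′)) n∈B
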